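{- Let $h$ and $k$ be positive integers with $3 \leq h \leq k-1$, and let $A$ be a set of $k$ integers such that $A \cap (-A) = \emptyset$. If \[|h^{\wedge}_{\pm}A| = 2hk - h^2 + 1,\] then $A_{abs} = d \ast \{1, 3, \ldots, 2k-1\}$, where $d$ is the smallest element of $A_{abs}$.
   Context: For a finite set $A = \{a_1, \ldots, a_k\}$ of integers (with distinct $a_i$) and a positive integer $h$, the restricted $h$-fold signed sumset is \[h^{\wedge}_{\pm}A = \left\{ \sum_{i=1}^{k} \lambda_i a_i : \lambda_i \in \{ -1,0,1\}, \ \sum_{i=1}^{k} |\lambda_i| = h \right\}.\] $-A = \{ -a : a \in A\}$, $A_{abs} = \{|a| : a \in A\}$, and for an integer $c$ and a set $S$ of integers, $c \ast S = \{cs : s \in S\}$. -}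

module Defs where

open import Data.Nat using (ℕ; _<_; _≤_)
open import Data.Integer using (ℤ; +_; -_; _+_; _*_; ∣_∣)
open import Data.Fin using (Fin)
open import Data.Vec using (Vec; []; _∷_; lookup)
open import Data.List using (List; length)
open import Data.List.Relation.Unary.Unique.Propositional using (Unique)
open import Data.List.Membership.Propositional using (_∈_)
open import Data.Product using (Σ; _×_)
open import Function.Bundles using (_⇔_)
open import Relation.Binary.PropositionalEquality using (_≡_; _≢_)

data Coef : Set where
  neg zer pos : Coef

coefVal : Coef → ℤ
coefVal neg = - (+ 1)
coefVal zer = + 0
coefVal pos = + 1

coefAbs : Coef → ℕ
coefAbs neg = 1
coefAbs zer = 0
coefAbs pos = 1

weight : ∀ {k} → Vec Coef k → ℕ
weight [] = 0
weight (c ∷ cs) = coefAbs c Data.Nat.+ weight cs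

signedSum : ∀ {k} → Vec Coef k → Vec ℤ k → ℤ
signedSum [] [] = + 0
signedSum (c ∷ cs) (a ∷ as) = coefVal c * a + signedSum cs as

-- x ∈ h^∧_± A, where A = {a_1,…,a_k} is given by the vector (a_1,…,a_k)
InRestrictedSignedSumset : ℕ → ∀ {k} → Vec ℤ k → ℤ → Set
InRestrictedSignedSumset h {k} A x =
  Σ (Vec Coef k) λ c → weight c ≡ h × signedSum c A ≡ x

HasCard : (ℤ → Set) → ℕ → Set
HasCard P n = Σ (List ℤ) λ L → Unique L × length L ≡ n × (∀ x → (x ∈ L) ⇔ P x)

Distinct : ∀ {k} → Vec ℤ k → Set
Distinct {k} A = (i j : Fin k) → lookup A i ≡ lookup A j → i ≡ j

DisjointFromNeg : ∀ {k} → Vec ℤ k → Set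
DisjointFromNeg {k} A = (i j : Fin k) → lookup A i ≢ - lookup A j

InAbs : ∀ {k} → Vec ℤ k → ℕ → Set
InAbs {k} A y = Σ (Fin k) λ i → ∣ lookup A i ∣ ≡ y

IsMinAbs : ∀ {k} → Vec ℤ k → ℕ → Set
IsMinAbs A d = InAbs A d × (∀ y → InAbs A y → d ≤ y)

{-# OPTIONS --safe #-}

-- Replacing A by its absolute values changes nothing, so let A consist of k
-- positive integers and put m = k − h.  With λᵢ = 1 − cᵢ the sumset becomes
-- the set D of the sums Σ cᵢ aᵢ, cᵢ ∈ {0,1,2}, with exactly m coefficients 1,
-- and the claim is |D| > k² − m² + 1 unless A = d · {1, 3, …, 2k − 1}.
--
-- For m = 1 remove the largest element x and let a be the smallest one.  The
-- sums of the remaining set, shifted by 2x, all lie at or above 2x + a, so it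
-- suffices to find 2k − 1 sums below 2x + a.  These are A itself, x + 2a, and
-- one sum for each of the other k − 2 elements i: x + 2i if 2i < x + a, and
-- a + 2i otherwise.  When the latter collides with some x + 2l, it is replaced
-- by p + 2l or p + 2i (they differ by x − a), where p is chosen such that p − a
-- is not divisible by 2N, N being the largest power of 2 dividing all
-- differences of A: then no p + 2q equals an a + 2r or an x + 2r.
--
-- For larger m remove x and pass from m to m − 1: the sums with coefficient 1
-- at x contribute one layer, and h further sums lie below and h above it.
module Submission where

open import Data.Empty using (⊥; ⊥-elim)
open import Data.List using (List; []; _∷_; _++_; length; map; upTo; initLast; _∷ʳ′_)
-- solve quotes its list of variables, which an overloaded _∷_ leaves unresolved.
open import Data.List using () renaming (_∷_ to _▸_; [] to ε)
open import Data.List.Properties using (length-++; length-map; length-upTo)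
open import Data.List.Membership.Propositional using (_∈_; _∉_; find; lose)
open import Data.List.Membership.Propositional.Properties using (∈-++⁺ˡ; ∈-++⁺ʳ; ∈-++⁻; ∈-∃++; ∈-upTo⁺; ∈-upTo⁻; ∈-map⁻)
open import Data.List.Relation.Binary.Permutation.Propositional using (_↭_; refl; prep; swap; trans; ↭-sym; ↭⇒↭ₛ)
open import Data.List.Relation.Binary.Permutation.Propositional.Properties using (∈-resp-↭; All-resp-↭; ↭-length)
import Data.List.Relation.Binary.Permutation.Setoid.Properties as Permutationₛ
open import Data.List.Relation.Unary.All as All using (All; []; _∷_; all?)
import Data.List.Relation.Unary.All.Properties as All
open import Data.List.Relation.Unary.AllPairs as AllPairs using (AllPairs; []; _∷_)
open import Data.List.Relation.Unary.Any using (here; there; any?)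
open import Data.List.Relation.Unary.Linked using (Linked; [-]; _∷_)
open import Data.List.Relation.Unary.Linked.Properties using (Linked⇒AllPairs)
open import Data.List.Relation.Unary.Unique.Propositional using (Unique)
import Data.List.Relation.Unary.Unique.Propositional.Properties as Unique
open import Data.Nat using (ℕ; zero; suc; _+_; _*_; _∸_; _≤_; _≥_; _<_; _>_; z≤n; s≤s; z<s; NonZero; >-nonZero)
open import Data.Nat.Divisibility using (_∣_; divides; _∣?_; _∣0; 1∣_; ∣⇒≤; ∣m+n∣m⇒∣n; ∣m∣n⇒∣m+n; *-monoʳ-∣; n∣m*n)
open import Data.Nat.ListAction using (sum)
open import Data.Nat.Properties
open import Data.Nat.Tactic.RingSolver using (solve; solve-∀)
open import Data.Product using (Σ; ∃; _×_; _,_; proj₁; proj₂)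
open import Data.Sum using (_⊎_; inj₁; inj₂)
open import Function using (_∘_; id)
open import Level using (0ℓ)
open import Relation.Binary.Definitions using (tri<; tri≈; tri>)
open import Relation.Binary.PropositionalEquality using (_≡_; _≢_; refl; sym; cong; cong₂; subst; subst₂; setoid; module ≡-Reasoning) renaming (trans to ≡-trans)
import Relation.Binary.Construct.Flip.EqAndOrd as Flip
open import Relation.Nullary using (¬_; Dec; yes; no; ¬?; _×-dec_; decidable-stable)
open import Relation.Nullary.Decidable using (map′; from-yes)
open import Relation.Unary using (Pred; Decidable)
open import Algebra.Properties.CommutativeSemigroup +-commutativeSemigroup using (x∙yz≈y∙xz)
open import Data.List.Membership.DecPropositional _≟_ using (_∈?_)
open import Data.List.Relation.Unary.Unique.DecPropositional _≟_ using (unique?)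
open import Data.List.Sort (Flip.decTotalOrder ≤-decTotalOrder) using (sort; sort-↭; sort-↗)

-- A Farkas-style rule: u ≤ v follows from the sum p ≤ q of the hypotheses,
-- s being the slack.
linear : ∀ {p q u v} s → p ≤ q → u + q + s ≡ v + p → u ≤ v
linear {p} {q} {u} {v} s p≤q eq = +-cancelʳ-≤ q u v (begin
  u + q      ≤⟨ m≤m+n (u + q) s ⟩
  u + q + s  ≡⟨ eq ⟩
  v + p      ≤⟨ +-monoʳ-≤ v p≤q ⟩
  v + q      ∎)
  where open ≤-Reasoning

infixr 5 _⊕_
_⊕_ : ∀ {a b c d} → a ≤ b → c ≤ d → a + c ≤ b + d
_⊕_ = +-mono-≤

1≰0 : ¬ (1 ≤ 0)
1≰0 ()

eq≤ : ∀ {m n} → m ≡ n → m ≤ n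
eq≤ = ≤-reflexive

eq≥ : ∀ {m n} → m ≡ n → n ≤ m
eq≥ = ≤-reflexive ∘ sym

-- Lower bounds on cardinalities

AtLeast : ℕ → Pred ℕ 0ℓ → Set
AtLeast n P = ∃ λ L → Unique L × All P L × n ≤ length L

module _ {P Q : Pred ℕ 0ℓ} where

  atLeast-map : ∀ {n} (f : ℕ → ℕ) → (∀ {u v} → f u ≡ f v → u ≡ v) →
                (∀ {v} → P v → Q (f v)) → AtLeast n P → AtLeast n Q
  atLeast-map f inj pq (L , uL , pL , n≤) =
    map f L , Unique.map⁺ inj uL , All.map⁺ (All.map pq pL) ,
    subst (_ ≤_) (sym (length-map f L)) n≤

  atLeast-⊆ : ∀ {n} → (∀ {v} → P v → Q v) → AtLeast n P → AtLeast n Q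
  atLeast-⊆ pq (L , uL , pL , n≤) = L , uL , All.map pq pL , n≤

  atLeast-∪ : ∀ {m n} → (∀ {v} → P v → Q v → ⊥) → AtLeast m P → AtLeast n Q →
              AtLeast (m + n) (λ v → P v ⊎ Q v)
  atLeast-∪ disj (L , uL , pL , m≤) (M , uM , qM , n≤) =
    L ++ M ,
    Unique.++⁺ uL uM (λ { (v∈L , v∈M) → disj (All.lookup pL v∈L) (All.lookup qM v∈M) }) ,
    All.++⁺ (All.map inj₁ pL) (All.map inj₂ qM) ,
    subst (_ ≤_) (sym (length-++ L)) (m≤ ⊕ n≤)

atLeast-≤ : ∀ {m n P} → m ≤ n → AtLeast n P → AtLeast m P
atLeast-≤ m≤n (L , uL , pL , n≤) = L , uL , pL , ≤-trans m≤n n≤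

singleton : ∀ {P : Pred ℕ 0ℓ} v → P v → AtLeast 1 P
singleton v pv = v ∷ [] , [] ∷ [] , pv ∷ [] , ≤-refl

-- Values are chosen through a relation `G`, so that a choice may rest on a case distinction;
-- injectivity then concerns `G` alone and is shown by matching on its constructors.
atLeast-choice : ∀ {P : Pred ℕ 0ℓ} (G : ℕ → ℕ → Set) (M : List ℕ) → Unique M →
                 (∀ {i} → i ∈ M → ∃ (G i)) → (∀ {i j w} → G i w → G j w → i ≡ j) →
                 (∀ {i w} → G i w → P w) → AtLeast (length M) P
atLeast-choice {P} G M uM choose inj ok =
  atLeast-⊆ (λ { (_ , _ , g) → ok g }) (go M uM choose)
  where
  go : ∀ N → Unique N → (∀ {i} → i ∈ N → ∃ (G i)) →
       AtLeast (length N) (λ w → ∃ λ i → i ∈ N × G i w)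
  go [] _ _ = [] , [] , [] , z≤n
  go (i ∷ N) (i∉N ∷ uN) ch with ch (here refl) | go N uN (ch ∘ there)
  ... | w , gw | L , uL , gL , n≤ =
    w ∷ L ,
    All.map (λ { (j , j∈N , gj) refl → All.lookup i∉N j∈N (inj gw gj) }) gL ∷ uL ,
    (i , here refl , gw) ∷ All.map (λ { (j , j∈N , gj) → j , there j∈N , gj }) gL ,
    s≤s n≤

-- DropSum m as v says v = Σ cᵢ aᵢ with cᵢ ∈ {0,1,2} and cᵢ = 1 exactly m times;
-- with λᵢ = 1 − cᵢ, the signed sum Σ λᵢ aᵢ is sum as − v.
data DropSum : ℕ → List ℕ → ℕ → Set where
  nil  : DropSum 0 [] 0
  zer  : ∀ {m a as v} → DropSum m as v → DropSum m (a ∷ as) v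
  one  : ∀ {m a as v} → DropSum m as v → DropSum (suc m) (a ∷ as) (a + v)
  two  : ∀ {m a as v} → DropSum m as v → DropSum m (a ∷ as) (2 * a + v)

-- Permutation, reflection and the simplest drop sums

Descending : List ℕ → Set
Descending = AllPairs _>_

dropSum-↭ : ∀ {m as bs v} → as ↭ bs → DropSum m as v → DropSum m bs v
dropSum-↭ refl s = s
dropSum-↭ (prep x p) (zer s) = zer (dropSum-↭ p s)
dropSum-↭ (prep x p) (one s) = one (dropSum-↭ p s)
dropSum-↭ (prep x p) (two s) = two (dropSum-↭ p s)
dropSum-↭ (swap x y p) (zer (zer s)) = zer (zer (dropSum-↭ p s))
dropSum-↭ (swap x y p) (zer (one s)) = one (zer (dropSum-↭ p s))
dropSum-↭ (swap x y p) (zer (two s)) = two (zer (dropSum-↭ p s))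
dropSum-↭ (swap x y p) (one (zer s)) = zer (one (dropSum-↭ p s))
dropSum-↭ (swap x y p) (one (one {v = v} s)) =
  subst (DropSum _ _) (x∙yz≈y∙xz y x v) (one (one (dropSum-↭ p s)))
dropSum-↭ (swap x y p) (one (two {v = v} s)) =
  subst (DropSum _ _) (x∙yz≈y∙xz (2 * y) x v) (two (one (dropSum-↭ p s)))
dropSum-↭ (swap x y p) (two (zer s)) = zer (two (dropSum-↭ p s))
dropSum-↭ (swap x y p) (two (one {v = v} s)) =
  subst (DropSum _ _) (x∙yz≈y∙xz y (2 * x) v) (one (two (dropSum-↭ p s)))
dropSum-↭ (swap x y p) (two (two {v = v} s)) =
  subst (DropSum _ _) (x∙yz≈y∙xz (2 * y) (2 * x) v) (two (two (dropSum-↭ p s)))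
dropSum-↭ (trans p q) s = dropSum-↭ q (dropSum-↭ p s)

-- Exchanging the coefficients 0 and 2 keeps the number of ones; for signed sums this is the
-- symmetry λ ↦ -λ.
dropSum-reflect : ∀ {m as v} → DropSum m as v → ∃ λ w → DropSum m as w × v + w ≡ 2 * sum as
dropSum-reflect nil = 0 , nil , refl
dropSum-reflect (zer {a = a} {as} {v} s) with dropSum-reflect s
... | w , t , eq = 2 * a + w , two t , (begin
  v + (2 * a + w)   ≡⟨ shuffle v a w ⟩
  2 * a + (v + w)   ≡⟨ cong (2 * a +_) eq ⟩
  2 * a + 2 * sum as ≡⟨ *-distribˡ-+ 2 a (sum as) ⟨
  2 * (a + sum as)  ∎)
  where
  open ≡-Reasoning
  shuffle : ∀ v a w → v + (2 * a + w) ≡ 2 * a + (v + w)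
  shuffle = solve-∀
dropSum-reflect (one {a = a} {as} {v} s) with dropSum-reflect s
... | w , t , eq = a + w , one t , (begin
  (a + v) + (a + w) ≡⟨ shuffle v a w ⟩
  2 * a + (v + w)   ≡⟨ cong (2 * a +_) eq ⟩
  2 * a + 2 * sum as ≡⟨ *-distribˡ-+ 2 a (sum as) ⟨
  2 * (a + sum as)  ∎)
  where
  open ≡-Reasoning
  shuffle : ∀ v a w → (a + v) + (a + w) ≡ 2 * a + (v + w)
  shuffle = solve-∀
dropSum-reflect (two {a = a} {as} {v} s) with dropSum-reflect s
... | w , t , eq = w , zer t , (begin
  (2 * a + v) + w   ≡⟨ +-assoc (2 * a) v w ⟩
  2 * a + (v + w)   ≡⟨ cong (2 * a +_) eq ⟩
  2 * a + 2 * sum as ≡⟨ *-distribˡ-+ 2 a (sum as) ⟨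
  2 * (a + sum as)  ∎)
  where
  open ≡-Reasoning

atLeast-reflect : ∀ {n m as b} → AtLeast n (λ v → DropSum m as v × v < b) →
                  AtLeast n (λ v → DropSum m as v × 2 * sum as < v + b)
atLeast-reflect {n} {m} {as} {b} (L , uL , pL , n≤) =
  atLeast-≤ n≤ (atLeast-choice G L uL (λ v∈L → choose (All.lookup pL v∈L)) inj ok)
  where
  G : ℕ → ℕ → Set
  G v w = v < b × DropSum m as w × v + w ≡ 2 * sum as
  choose : ∀ {v} → DropSum m as v × v < b → ∃ (G v)
  choose (s , v<b) with dropSum-reflect s
  ... | w , t , eq = w , v<b , t , eq
  inj : ∀ {i j w} → G i w → G j w → i ≡ j
  inj {i} {j} {w} (_ , _ , e) (_ , _ , e′) = +-cancelʳ-≡ w i j (≡-trans e (sym e′))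
  ok : ∀ {i w} → G i w → DropSum m as w × 2 * sum as < w + b
  ok {i} {w} (i<b , t , e) = t , subst (_< w + b) e (subst (i + w <_) (+-comm b w) (+-monoˡ-< w i<b))

dropSum-0 : ∀ as → DropSum 0 as 0
dropSum-0 [] = nil
dropSum-0 (a ∷ as) = zer (dropSum-0 as)

dropSum-double : ∀ {as q} → q ∈ as → DropSum 0 as (2 * q)
dropSum-double {q ∷ as} (here refl) = subst (DropSum 0 _) (+-identityʳ (2 * q)) (two (dropSum-0 as))
dropSum-double (there q∈) = zer (dropSum-double q∈)

dropSum-single : ∀ {as p} → p ∈ as → DropSum 1 as p
dropSum-single {p ∷ as} (here refl) = subst (DropSum 1 _) (+-identityʳ p) (one (dropSum-0 as))
dropSum-single (there p∈) = zer (dropSum-single p∈)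

dropSum-pair : ∀ {as p q} → p ∈ as → q ∈ as → p ≢ q → DropSum 1 as (p + 2 * q)
dropSum-pair (here refl) (here refl) p≢q = ⊥-elim (p≢q refl)
dropSum-pair (here refl) (there q∈) _ = one (dropSum-double q∈)
dropSum-pair {p = p} {q} (there p∈) (here refl) _ =
  subst (DropSum 1 _) (+-comm (2 * q) p) (two (dropSum-single p∈))
dropSum-pair (there p∈) (there q∈) p≢q = zer (dropSum-pair p∈ q∈ p≢q)

dropSum-length : ∀ {m as v} → DropSum m as v → m ≤ length as
dropSum-length nil = z≤n
dropSum-length (zer s) = m≤n⇒m≤1+n (dropSum-length s)
dropSum-length (one s) = s≤s (dropSum-length s)
dropSum-length (two s) = m≤n⇒m≤1+n (dropSum-length s)

-- The window below 2x + a

descending⇒unique : ∀ {as} → Descending as → Unique as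
descending⇒unique = AllPairs.map (λ q<p p≡q → <-irrefl (sym p≡q) q<p)

descending-∷ʳ : ∀ {a} M → Descending (M ++ a ∷ []) → All (a <_) M × Descending M
descending-∷ʳ [] _ = [] , []
descending-∷ʳ (q ∷ M) (h ∷ desc) with descending-∷ʳ M desc
... | a<M , descM = All.lookup h (∈-++⁺ʳ M (here refl)) ∷ a<M , All.++⁻ˡ M h ∷ descM

-- As the list descends, the first failure of `P` is the largest.
largest-exception : ∀ {P : Pred ℕ 0ℓ} → Decidable P → ∀ as → Descending as → ¬ All P as →
                    ∃ λ p → p ∈ as × ¬ P p × (∀ {q} → q ∈ as → p < q → P q)
largest-exception P? [] _ ¬all = ⊥-elim (¬all [])
largest-exception P? (x ∷ as) (h ∷ desc) ¬all with P? x
... | no ¬px = x , here refl , ¬px , λ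
  { (here refl) x<x → ⊥-elim (<-irrefl refl x<x)
  ; (there q∈) x<q → ⊥-elim (<-asym x<q (All.lookup h q∈)) }
... | yes px with largest-exception P? as desc (¬all ∘ (px ∷_))
...   | p , p∈ , ¬pp , max = p , there p∈ , ¬pp , λ
  { (here refl) _ → px
  ; (there q∈) p<q → max q∈ p<q }

another-member : ∀ {M} → Unique M → 2 ≤ length M → ∀ p → ∃ λ z → z ∈ M × z ≢ p
another-member {y ∷ z ∷ M} ((y≢z ∷ _) ∷ _) _ p with y ≟ p
... | yes refl = z , there (here refl) , y≢z ∘ sym
... | no y≢p = y , here refl , y≢p
another-member {_ ∷ []} _ (s≤s ()) p

module Window (x a : ℕ) (M : List ℕ) (desc : Descending (x ∷ M ++ a ∷ [])) (0<a : 0 < a) where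

  A : List ℕ
  A = x ∷ M ++ a ∷ []

  InWindow : ℕ → Set
  InWindow w = DropSum 1 A w × w < 2 * x + a

  x∈ : x ∈ A
  x∈ = here refl

  a∈ : a ∈ A
  a∈ = there (∈-++⁺ʳ M (here refl))

  M⊆ : ∀ {q} → q ∈ M → q ∈ A
  M⊆ = there ∘ ∈-++⁺ˡ

  a<M : ∀ {q} → q ∈ M → a < q
  a<M = All.lookup (proj₁ (descending-∷ʳ M (AllPairs.tail desc)))

  M<x : ∀ {q} → q ∈ M → q < x
  M<x q∈ = All.lookup (AllPairs.head desc) (∈-++⁺ˡ q∈)

  a<x : a < x
  a<x = All.lookup (AllPairs.head desc) (∈-++⁺ʳ M (here refl))

  ≤x : ∀ {q} → q ∈ A → q ≤ x
  ≤x (here refl) = ≤-refl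
  ≤x (there q∈) = <⇒≤ (All.lookup (AllPairs.head desc) q∈)

  a≤ : ∀ {q} → q ∈ A → a ≤ q
  a≤ (here refl) = <⇒≤ a<x
  a≤ (there q∈) with ∈-++⁻ M q∈
  ... | inj₁ q∈M = <⇒≤ (a<M q∈M)
  ... | inj₂ (here refl) = ≤-refl

  uniqueM : Unique M
  uniqueM = descending⇒unique (proj₂ (descending-∷ʳ M (AllPairs.tail desc)))

  -- The sums assigned by default to a small `l` and a large `i` coincide. Here `l` ranges over `A`,
  -- not only `M`, because `x + 2 * a` is counted as well.
  record Collision (l i : ℕ) : Set where
    field
      l∈ : l ∈ A
      i∈ : i ∈ M
      eq : x + 2 * l ≡ a + 2 * i

  open Collision

  low : ∀ {l i} → Collision l i → 2 * l < x + a
  low {l} {i} c = linear 1 (eq≤ (eq c) ⊕ M<x (i∈ c) ⊕ M<x (i∈ c)) (solve (x ▸ l ▸ a ▸ i ▸ ε))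

  high : ∀ {l i} → Collision l i → x + a ≤ 2 * i
  high {l} {i} c = linear 0 (eq≤ (eq c) ⊕ a≤ (l∈ c) ⊕ a≤ (l∈ c)) (solve (x ▸ l ▸ a ▸ i ▸ ε))

  collision-unique : ∀ {l i j} → Collision l i → Collision l j → i ≡ j
  collision-unique c c′ = *-cancelˡ-≡ _ _ 2 (+-cancelˡ-≡ a _ _ (≡-trans (sym (eq c)) (eq c′)))

  -- The two members of a collision lie on different sides of the midpoint of `a` and `x`.
  low≢high : ∀ {l i l′ i′} → Collision l i → Collision l′ i′ → l ≢ i′
  low≢high c c′ refl = <⇒≱ (low c) (high c′)

  record Marker (p : ℕ) : Set where
    field
      p∈ : p ∈ A
      a<p : a < p
      p<x : p < x
      sep-a : ∀ {q r} → q ∈ A → r ∈ A → p + 2 * q ≢ a + 2 * r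
      sep-x : ∀ {q r} → q ∈ A → r ∈ A → p + 2 * q ≢ x + 2 * r

  -- A spare sum: its upper bound keeps it apart from all sums in `AboveWindow`.
  Bonus : ℕ → Set
  Bonus β = DropSum 1 A β × β < x + 2 * a × β ∉ A

  AboveWindow : ℕ → Set
  AboveWindow w = DropSum 1 A w × x + 2 * a < w × w < 2 * x + a

  -- A replacement is lost when p itself is in the colliding pair; this happens
  -- for at most one i, whose place is then taken by a bonus sum.
  Lost : ℕ → ℕ → ℕ → Set
  Lost p l i = (x + 2 * a < p + 2 * l × p ≡ l) ⊎ (p + 2 * l ≤ x + 2 * a × p ≡ i)

  module Count (p β : ℕ) (marker : ∀ {l i} → Collision l i → Marker p)
               (lost-bonus : ∀ {l i} → Collision l i → Lost p l i → Bonus β) where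

    -- In a collision `p + 2 * l` and `p + 2 * i` differ by x - a, the length of the interval from
    -- `x + 2 * a` to `2 * x + a`, so one of them falls inside it.
    data Above (i w : ℕ) : Set where
      x+2i : i ∈ M → 2 * i < x + a → w ≡ x + 2 * i → Above i w
      a+2i : i ∈ M → x + a ≤ 2 * i → (∀ {l} → l ∈ A → x + 2 * l ≢ a + 2 * i) → w ≡ a + 2 * i → Above i w
      p+2l : ∀ {l} → Collision l i → p ≢ l → x + 2 * a < p + 2 * l → w ≡ p + 2 * l → Above i w
      p+2i : ∀ {l} → Collision l i → p ≢ i → p + 2 * l < x + 2 * a → w ≡ p + 2 * i → Above i w

    data New (i w : ℕ) : Set where
      above : Above i w → New i w
      lost  : ∀ {l} → Collision l i → p ≡ l ⊎ p ≡ i → Bonus β → w ≡ β → New i w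

    choose : ∀ {i} → i ∈ M → ∃ (New i)
    choose {i} i∈ with 2 * i <? x + a
    ... | yes low = _ , above (x+2i i∈ low refl)
    ... | no ¬low with any? (λ l → x + 2 * l ≟ a + 2 * i) A
    ...   | no ¬coll = _ , above (a+2i i∈ (≮⇒≥ ¬low) (λ l∈ eq → ¬coll (lose l∈ eq)) refl)
    ...   | yes coll with find coll
    ...     | l , l∈ , eq = colliding (record { l∈ = l∈ ; i∈ = i∈ ; eq = eq })
      where
      colliding : Collision l i → ∃ (New i)
      colliding c with x + 2 * a <? p + 2 * l
      ... | yes p+2l-above with p ≟ l
      ...   | yes p≡l = _ , lost c (inj₁ p≡l) (lost-bonus c (inj₁ (p+2l-above , p≡l))) refl
      ...   | no p≢l = _ , above (p+2l c p≢l p+2l-above refl)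
      colliding c | no ¬above with p ≟ i
      ...   | yes p≡i = _ , lost c (inj₂ p≡i) (lost-bonus c (inj₂ (≮⇒≥ ¬above , p≡i))) refl
      -- Separation from `x + 2 * a` makes the inequality strict.
      ...   | no p≢i = _ , above (p+2i c p≢i (≤∧≢⇒< (≮⇒≥ ¬above) (Marker.sep-x (marker c) l∈ a∈)) refl)

    above-inWindow : ∀ {i w} → Above i w → AboveWindow w
    above-inWindow {i} (x+2i i∈ low refl) =
      ( dropSum-pair x∈ (M⊆ i∈) (λ x≡i → <-irrefl (sym x≡i) (M<x i∈))
           , linear 1 (a<M i∈ ⊕ a<M i∈) (solve (x ▸ a ▸ i ▸ ε))
           , linear 0 low (solve (x ▸ a ▸ i ▸ ε)))
    above-inWindow {i} (a+2i i∈ high ¬coll refl) =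
      ( dropSum-pair a∈ (M⊆ i∈) (λ a≡i → <-irrefl a≡i (a<M i∈))
           , ≤∧≢⇒< {x + 2 * a} {a + 2 * i} (linear 0 high (solve (x ▸ a ▸ i ▸ ε))) (¬coll a∈)
           , linear 1 (M<x i∈ ⊕ M<x i∈) (solve (x ▸ a ▸ i ▸ ε)))
    above-inWindow {i} (p+2l {l} c p≢l p+2l-above refl) =
      ( dropSum-pair p∈ (l∈ c) p≢l
           , p+2l-above
           , linear 1 (low c ⊕ p<x) (solve (x ▸ a ▸ l ▸ p ▸ ε)))
      where open Marker (marker c)
    above-inWindow {i} (p+2i {l} c p≢i below refl) =
      ( dropSum-pair p∈ (M⊆ (i∈ c)) p≢i
           , linear 0 (eq≤ (eq c) ⊕ a<p ⊕ a≤ (l∈ c) ⊕ a≤ (l∈ c)) (solve (x ▸ a ▸ l ▸ p ▸ i ▸ ε))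
           , linear 0 (eq≥ (eq c) ⊕ below) (solve (x ▸ a ▸ l ▸ p ▸ i ▸ ε)))
      where open Marker (marker c)

    new-inWindow : ∀ {i w} → New i w → AboveWindow w ⊎ Bonus w
    new-inWindow (above n) = inj₁ (above-inWindow n)
    new-inWindow (lost _ _ b refl) = inj₂ b

    cancel-2* : ∀ c {i j} → c + 2 * i ≡ c + 2 * j → i ≡ j
    cancel-2* c e = *-cancelˡ-≡ _ _ 2 (+-cancelˡ-≡ c _ _ e)

    above-injective : ∀ {i j w} → Above i w → Above j w → i ≡ j
    above-injective (x+2i _ _ e) (x+2i _ _ e′) = cancel-2* x (≡-trans (sym e) e′)
    above-injective (x+2i j∈ _ e) (a+2i _ _ ¬coll e′) = ⊥-elim (¬coll (M⊆ j∈) (≡-trans (sym e) e′))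
    above-injective (x+2i j∈ _ e) (p+2l c _ _ e′) =
      ⊥-elim (Marker.sep-x (marker c) (l∈ c) (M⊆ j∈) (≡-trans (sym e′) e))
    above-injective (x+2i j∈ _ e) (p+2i c _ _ e′) =
      ⊥-elim (Marker.sep-x (marker c) (M⊆ (i∈ c)) (M⊆ j∈) (≡-trans (sym e′) e))
    above-injective (a+2i _ _ ¬coll e′) (x+2i j∈ _ e) = ⊥-elim (¬coll (M⊆ j∈) (≡-trans (sym e) e′))
    above-injective (a+2i _ _ _ e) (a+2i _ _ _ e′) = cancel-2* a (≡-trans (sym e) e′)
    above-injective (a+2i j∈ _ _ e) (p+2l c _ _ e′) =
      ⊥-elim (Marker.sep-a (marker c) (l∈ c) (M⊆ j∈) (≡-trans (sym e′) e))
    above-injective (a+2i j∈ _ _ e) (p+2i c _ _ e′) =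
      ⊥-elim (Marker.sep-a (marker c) (M⊆ (i∈ c)) (M⊆ j∈) (≡-trans (sym e′) e))
    above-injective (p+2l c _ _ e′) (x+2i j∈ _ e) =
      ⊥-elim (Marker.sep-x (marker c) (l∈ c) (M⊆ j∈) (≡-trans (sym e′) e))
    above-injective (p+2l c _ _ e′) (a+2i j∈ _ _ e) =
      ⊥-elim (Marker.sep-a (marker c) (l∈ c) (M⊆ j∈) (≡-trans (sym e′) e))
    above-injective (p+2l {l} c _ _ e) (p+2l {l′} c′ _ _ e′) with cancel-2* p {l} {l′} (≡-trans (sym e) e′)
    ... | refl = collision-unique c c′
    above-injective (p+2l c _ _ e) (p+2i c′ _ _ e′) =
      ⊥-elim (low≢high c c′ (cancel-2* p (≡-trans (sym e) e′)))
    above-injective (p+2i c _ _ e′) (x+2i j∈ _ e) =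
      ⊥-elim (Marker.sep-x (marker c) (M⊆ (i∈ c)) (M⊆ j∈) (≡-trans (sym e′) e))
    above-injective (p+2i c _ _ e′) (a+2i j∈ _ _ e) =
      ⊥-elim (Marker.sep-a (marker c) (M⊆ (i∈ c)) (M⊆ j∈) (≡-trans (sym e′) e))
    above-injective (p+2i c′ _ _ e′) (p+2l c _ _ e) =
      ⊥-elim (low≢high c c′ (cancel-2* p (≡-trans (sym e) e′)))
    above-injective (p+2i _ _ _ e) (p+2i _ _ _ e′) = cancel-2* p (≡-trans (sym e) e′)

    injective : ∀ {i j w} → New i w → New j w → i ≡ j
    injective (above n) (above n′) = above-injective n n′
    injective (above n) (lost _ _ (_ , below , _) refl) =
      ⊥-elim (<-asym below (proj₁ (proj₂ (above-inWindow n))))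
    injective (lost _ _ (_ , below , _) refl) (above n) =
      ⊥-elim (<-asym below (proj₁ (proj₂ (above-inWindow n))))
    -- `p` lies in at most one colliding pair: the lower member determines the upper one, and no
    -- element is lower in one pair and upper in another.
    injective (lost c (inj₁ refl) _ _) (lost c′ (inj₁ refl) _ _) = collision-unique c c′
    injective (lost c (inj₁ refl) _ _) (lost c′ (inj₂ refl) _ _) = ⊥-elim (low≢high c c′ refl)
    injective (lost c (inj₂ refl) _ _) (lost c′ (inj₁ refl) _ _) = ⊥-elim (low≢high c′ c refl)
    injective (lost _ (inj₂ refl) _ _) (lost _ (inj₂ refl) _ _) = refl

    count : AtLeast (length A + (1 + length M)) InWindow
    count = atLeast-⊆ collect
      (atLeast-∪ disjoint
        (A , descending⇒unique desc , All.tabulate id , ≤-refl)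
        (atLeast-∪ disjoint′ (singleton (x + 2 * a) refl)
          (atLeast-choice New M uniqueM choose injective new-inWindow)))
      where
      new≢ : ∀ {w} → AboveWindow w ⊎ Bonus w → w ∉ A × w ≢ x + 2 * a
      new≢ (inj₁ (_ , x+2a<w , _)) =
        (λ w∈ → <⇒≱ x+2a<w (≤-trans (≤x w∈) (m≤m+n x (2 * a)))) , λ { refl → <-irrefl refl x+2a<w }
      new≢ (inj₂ (_ , below , w∉)) = w∉ , λ { refl → <-irrefl refl below }
      disjoint′ : ∀ {w} → w ≡ x + 2 * a → AboveWindow w ⊎ Bonus w → ⊥
      disjoint′ e n = proj₂ (new≢ n) e
      disjoint : ∀ {w} → w ∈ A → w ≡ x + 2 * a ⊎ (AboveWindow w ⊎ Bonus w) → ⊥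
      disjoint w∈ (inj₁ refl) = 1≰0 (linear 1 (≤x w∈ ⊕ 0<a ⊕ 0<a) (solve (x ▸ a ▸ ε)))
      disjoint w∈ (inj₂ n) = proj₁ (new≢ n) w∈
      x+2a< : x + 2 * a < 2 * x + a
      x+2a< = linear 0 a<x (solve (x ▸ a ▸ ε))
      collect : ∀ {w} → w ∈ A ⊎ (w ≡ x + 2 * a ⊎ (AboveWindow w ⊎ Bonus w)) → InWindow w
      collect {w} (inj₁ w∈) = dropSum-single w∈ , linear x (≤x w∈ ⊕ 0<a) (solve (x ▸ a ▸ w ▸ ε))
      collect (inj₂ (inj₁ refl)) = dropSum-pair x∈ a∈ (λ x≡a → <-irrefl (sym x≡a) a<x) , x+2a<
      collect (inj₂ (inj₂ (inj₁ (s , _ , w<)))) = s , w<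
      collect (inj₂ (inj₂ (inj₂ (s , w< , _)))) = s , <-trans w< x+2a<

  private
    e : ℕ → ℕ
    e q = q ∸ a

    a+e : ∀ {q} → q ∈ A → a + e q ≡ q
    a+e q∈ = m+[n∸m]≡n (a≤ q∈)

  Divides-differences : ℕ → Set
  Divides-differences N = All (λ q → N ∣ q ∸ a) A

  -- Doubling from 1 has to stop, since a divisor of the positive number `e x` is at most `e x`; the
  -- invariant `e x < N + fuel` turns exhausted fuel into a contradiction with this.
  maximal-modulus : ∃ λ N → Divides-differences N × ¬ Divides-differences (2 * N)
  maximal-modulus = search (e x) 1 (s≤s z≤n) (All.tabulate (λ {q} _ → 1∣ (q ∸ a))) ≤-refl
    where
    0<e : 0 < e x
    0<e = m<n⇒0<n∸m a<x
    search : ∀ fuel N → 0 < N → Divides-differences N → e x < N + fuel →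
             ∃ λ N → Divides-differences N × ¬ Divides-differences (2 * N)
    search fuel N 0<N div bound with all? (λ q → 2 * N ∣? q ∸ a) A
    ... | no ¬div = N , div , ¬div
    search zero N 0<N div bound | yes _ =
      ⊥-elim (<⇒≱ (subst (e x <_) (+-identityʳ N) bound)
                  (∣⇒≤ ⦃ >-nonZero 0<e ⦄ (All.lookup div x∈)))
    search (suc fuel) N 0<N div bound | yes div₂ =
      search fuel (2 * N) (linear N 0<N (solve (N ▸ ε))) div₂
             (linear 0 (bound ⊕ 0<N) (identity (e x) N fuel))
      where
      identity : ∀ y N f → suc y + (N + suc f + N) + 0 ≡ (2 * N + f) + (suc y + 1)
      identity = solve-∀

  module Modulus (N : ℕ) (div : Divides-differences N) where

    even-difference : ∀ {q} → q ∈ A → 2 * N ∣ 2 * e q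
    even-difference q∈ = *-monoʳ-∣ 2 (All.lookup div q∈)

    -- Subtracting `3 * a` leaves an equation between differences. The doubled ones vanish modulo
    -- `2 * N`, so `e p` and `e y` agree modulo `2 * N`.
    separated : ∀ {p y q r} → p ∈ A → y ∈ A → q ∈ A → r ∈ A →
                p + 2 * q ≡ y + 2 * r → 2 * N ∣ e y → 2 * N ∣ e p
    separated {p} {y} {q} {r} p∈ y∈ q∈ r∈ eq 2N∣y =
      ∣m+n∣m⇒∣n (subst (2 * N ∣_) (sym (≡-trans (+-comm (2 * e q) (e p)) differences))
                       (∣m∣n⇒∣m+n 2N∣y (even-difference r∈)))
                (even-difference q∈)
      where
      expand : ∀ a P Q → (a + P) + 2 * (a + Q) ≡ 3 * a + (P + 2 * Q)
      expand = solve-∀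
      differences : e p + 2 * e q ≡ e y + 2 * e r
      differences = +-cancelˡ-≡ (3 * a) _ _ (begin
        3 * a + (e p + 2 * e q)      ≡⟨ expand a (e p) (e q) ⟨
        (a + e p) + 2 * (a + e q)    ≡⟨ cong₂ (λ s t → s + 2 * t) (a+e p∈) (a+e q∈) ⟩
        p + 2 * q                    ≡⟨ eq ⟩
        y + 2 * r                    ≡⟨ cong₂ (λ s t → s + 2 * t) (a+e y∈) (a+e r∈) ⟨
        (a + e y) + 2 * (a + e r)    ≡⟨ expand a (e y) (e r) ⟩
        3 * a + (e y + 2 * e r)      ∎)
        where open ≡-Reasoning

    a-even : 2 * N ∣ e a
    a-even = subst (2 * N ∣_) (sym (n∸n≡0 a)) ((2 * N) ∣0)

    collision⇒x-even : ∀ {l i} → Collision l i → 2 * N ∣ e x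
    collision⇒x-even c = separated x∈ a∈ (l∈ c) (M⊆ (i∈ c)) (eq c) a-even

    -- The residue class of `a` modulo `2 * N` contains `x` too as soon as there is a collision, so
    -- `p` lies outside the class of both.
    odd-marker : ∀ {p l i} → p ∈ A → ¬ (2 * N ∣ e p) → Collision l i → Marker p
    odd-marker {p} p∈ odd c = record
      { p∈ = p∈
      ; a<p = ≤∧≢⇒< (a≤ p∈) λ { refl → odd a-even }
      ; p<x = ≤∧≢⇒< (≤x p∈) λ { refl → odd (collision⇒x-even c) }
      ; sep-a = λ q∈ r∈ eq → odd (separated p∈ a∈ q∈ r∈ eq a-even)
      ; sep-x = λ q∈ r∈ eq → odd (separated p∈ x∈ q∈ r∈ eq (collision⇒x-even c))
      }

    -- Without a bonus sum, A ∖ {a} is closed under + 2a below x, which forces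
    -- x = p + 2a for the largest odd p.
    module NoBonus (2≤M : 2 ≤ length M)
                   (closed : ∀ {s t} → s ∈ A → t ∈ A → s ≢ t → s + 2 * t < x + 2 * a → s + 2 * t ∈ A)
                   (p : ℕ) (p∈ : p ∈ A) (odd : ¬ (2 * N ∣ e p))
                   (largest : ∀ {q} → q ∈ A → p < q → 2 * N ∣ e q)
                   {l i : ℕ} (c : Collision l i) where

      open Marker (odd-marker p∈ odd c) hiding (p∈)

      step : ∀ {q} → q ∈ A → a < q → q < x → q + 2 * a ∈ A
      step q∈ a<q q<x = closed q∈ a∈ (λ q≡a → <-irrefl (sym q≡a) a<q) (+-monoˡ-< (2 * a) q<x)

      q<q+2a : ∀ q → q < q + 2 * a
      q<q+2a q = linear a 0<a (solve (q ▸ a ▸ ε))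

      x≡p+2a : x ≡ p + 2 * a
      x≡p+2a with p + 2 * a ≟ x
      ... | yes eq = sym eq
      -- 4a is twice the difference of the elements `p + 2 * a` and `p`, so `p` and p + 4a agree
      -- modulo `2 * N`; but the larger one is even by the choice of `p`.
      ... | no neq = ⊥-elim (odd (separated p∈ p+4a∈ p+2a∈ p∈ (solve (p ▸ a ▸ ε))
                                  (largest p+4a∈ (<-trans (q<q+2a p) (q<q+2a (p + 2 * a))))))
        where
        p+2a∈ = step p∈ a<p p<x
        p+4a∈ : (p + 2 * a) + 2 * a ∈ A
        p+4a∈ = step p+2a∈ (<-trans a<p (q<q+2a p)) (≤∧≢⇒< (≤x p+2a∈) neq)

      below-p : ∀ {q} → q ∈ A → a < q → q < x → q ≤ p
      below-p {q} q∈ a<q q<x =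
        linear 0 (≤x (step q∈ a<q q<x) ⊕ eq≤ x≡p+2a) (solve (q ▸ a ▸ p ▸ x ▸ ε))

      -- For a further middle element `z`, the element `z + 2 * a` is smaller than `x`, hence at
      -- most `p`, while `z` exceeds `a`.
      3a<p : 3 * a < p
      3a<p with another-member uniqueM 2≤M p
      ... | z , z∈ , z≢p = linear 0 (a<z ⊕ z+2a≤p) (solve (z ▸ a ▸ p ▸ ε))
        where
        a<z = a<M z∈
        z<p = ≤∧≢⇒< (below-p (M⊆ z∈) a<z (M<x z∈)) z≢p
        z+2a≤p : z + 2 * a ≤ p
        z+2a≤p = below-p (step (M⊆ z∈) a<z (M<x z∈)) (<-trans a<z (q<q+2a z))
                         (linear 0 (z<p ⊕ eq≥ x≡p+2a) (solve (z ▸ a ▸ p ▸ x ▸ ε)))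

      -- Both cases would force p ≤ 3a: the first because `i` is below `x`, the second because
      -- closure puts `p + 2 * l` into `A` and so at most at `x`.
      not-lost : ¬ Lost p l i
      not-lost (inj₁ (_ , refl)) =
        1≰0 (linear 2 (eq≤ (eq c) ⊕ M<x (i∈ c) ⊕ M<x (i∈ c) ⊕ eq≤ x≡p+2a ⊕ 3a<p)
                    (solve (p ▸ a ▸ i ▸ x ▸ ε)))
      not-lost (inj₂ (p+2l≤ , refl)) =
        1≰0 (linear 0 (≤x (closed p∈ (l∈ c) p≢l (≤∧≢⇒< p+2l≤ (sep-x (l∈ c) a∈))) ⊕ eq≥ (eq c)
                      ⊕ eq≤ x≡p+2a ⊕ eq≤ x≡p+2a ⊕ 3a<p)
                    (solve (p ▸ a ▸ l ▸ x ▸ ε)))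
        where
        p≢l : p ≢ l
        p≢l refl = 1≰0 (linear 0 (eq≤ (eq c) ⊕ a<x) (solve (p ▸ a ▸ x ▸ ε)))

  pair-bonus? : Dec (∃ λ s → s ∈ A × ∃ λ t → t ∈ A × s ≢ t × s + 2 * t < x + 2 * a × s + 2 * t ∉ A)
  pair-bonus? = map′ find (λ { (_ , s∈ , h) → lose s∈ h })
    (any? (λ s → map′ find (λ { (_ , t∈ , h) → lose t∈ h })
      (any? (λ t → ¬? (s ≟ t) ×-dec s + 2 * t <? x + 2 * a ×-dec ¬? (s + 2 * t ∈? A)) A)) A)

  window : 2 ≤ length M → AtLeast (length A + (1 + length M)) InWindow
  window 2≤M with maximal-modulus
  ... | N , div , ¬div with largest-exception (λ q → 2 * N ∣? q ∸ a) A desc ¬div | pair-bonus?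
  ...   | p , p∈ , odd , largest | yes (s , s∈ , t , t∈ , s≢t , s+2t< , s+2t∉) =
    Count.count p (s + 2 * t) (Modulus.odd-marker N div p∈ odd)
                (λ _ _ → dropSum-pair s∈ t∈ s≢t , s+2t< , s+2t∉)
  ...   | p , p∈ , odd , largest | no ¬bonus =
    -- The bonus value 0 is a mere default: no replacement is lost, so it is never counted.
    Count.count p 0 (Modulus.odd-marker N div p∈ odd)
                (λ c lost → ⊥-elim (Modulus.NoBonus.not-lost N div 2≤M closed p p∈ odd largest c lost))
    where
    closed : ∀ {s t} → s ∈ A → t ∈ A → s ≢ t → s + 2 * t < x + 2 * a → s + 2 * t ∈ A
    closed {s} {t} s∈ t∈ s≢t s+2t< = decidable-stable (s + 2 * t ∈? A)
      (λ ∉A → ¬bonus (s , s∈ , t , t∈ , s≢t , s+2t< , ∉A))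

-- Multiples of consecutive odd numbers

dropSum-≥ : ∀ {m as v b} → All (b ≤_) as → DropSum (suc m) as v → b ≤ v
dropSum-≥ (_ ∷ b≤) (zer s) = dropSum-≥ b≤ s
dropSum-≥ (b≤a ∷ _) (one s) = ≤-trans b≤a (m≤m+n _ _)
dropSum-≥ (_ ∷ b≤) (two s) = ≤-trans (dropSum-≥ b≤ s) (m≤n+m _ _)

-- Coefficient 2 at `x` lifts the sums of the rest to at least `2 * x + b`, above every window sum.
stack : ∀ {m n x as b} → All (b ≤_) as → AtLeast n (DropSum 1 as) →
        AtLeast m (λ v → DropSum 1 (x ∷ as) v × v < 2 * x + b) → AtLeast (m + n) (DropSum 1 (x ∷ as))
stack {m} {n} {x} {as} {b} b≤ many window =
  atLeast-⊆ (λ { (inj₁ (s , _)) → s ; (inj₂ (s , _)) → s })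
    (atLeast-∪ (λ { (_ , v<) (_ , ≤v) → <⇒≱ v< ≤v }) window
      (atLeast-map {Q = λ v → DropSum 1 (x ∷ as) v × 2 * x + b ≤ v} (2 * x +_)
        (+-cancelˡ-≡ (2 * x) _ _)
        (λ s → two s , +-monoʳ-≤ (2 * x) (dropSum-≥ b≤ s)) many))

atLeast-chain : ∀ {P : Pred ℕ 0ℓ} L → Linked _<_ L → All P L → AtLeast (length L) P
atLeast-chain L inc pL = L , AllPairs.map <⇒≢ (Linked⇒AllPairs <-trans inc) , pL , ≤-refl

atLeast-range : ∀ {P : Pred ℕ 0ℓ} n (f : ℕ → ℕ) → (∀ {s t} → f s ≡ f t → s ≡ t) →
                (∀ {t} → t < n → P (f t)) → AtLeast n P
atLeast-range n f inj p =
  atLeast-map f inj p (upTo n , Unique.upTo⁺ n , All.tabulate ∈-upTo⁻ , ≤-reflexive (sym (length-upTo n)))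

odds : ℕ → ℕ → List ℕ
odds d zero = []
odds d (suc n) = d * (2 * n + 1) ∷ odds d n

IsOdds : List ℕ → Set
IsOdds as = ∃ λ d → ∃ λ n → as ≡ odds d n

length-odds : ∀ d n → length (odds d n) ≡ n
length-odds d zero = refl
length-odds d (suc n) = cong suc (length-odds d n)

odds-≥ : ∀ d n → All (d ≤_) (odds d n)
odds-≥ d zero = []
odds-≥ d (suc n) = linear (d * (2 * n)) (≤-refl {0}) (identity d n) ∷ odds-≥ d n
  where
  identity : ∀ d n → d + 0 + d * (2 * n) ≡ d * (2 * n + 1) + 0
  identity = solve-∀

dropSum-scale : ∀ {m} d n {v} → DropSum m (odds 1 n) v → DropSum m (odds d n) (d * v)
dropSum-scale d zero nil = subst (DropSum 0 []) (sym (*-zeroʳ d)) nil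
dropSum-scale d (suc n) (zer s) = zer (dropSum-scale d n s)
dropSum-scale d (suc n) (one {v = v} s) = subst (DropSum _ _) (identity d n v) (one (dropSum-scale d n s))
  where
  identity : ∀ d n v → d * (2 * n + 1) + d * v ≡ d * (1 * (2 * n + 1) + v)
  identity = solve-∀
dropSum-scale d (suc n) (two {v = v} s) = subst (DropSum _ _) (identity d n v) (two (dropSum-scale d n s))
  where
  identity : ∀ d n v → 2 * (d * (2 * n + 1)) + d * v ≡ d * (2 * (1 * (2 * n + 1)) + v)
  identity = solve-∀

-- An enumeration that lets finite claims about small sets of odd numbers be settled by computation.
dropSums : ℕ → List ℕ → List ℕ
dropSums zero [] = 0 ∷ []
dropSums (suc m) [] = []
dropSums zero (a ∷ as) = dropSums 0 as ++ map (2 * a +_) (dropSums 0 as)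
dropSums (suc m) (a ∷ as) =
  (dropSums (suc m) as ++ map (2 * a +_) (dropSums (suc m) as)) ++ map (a +_) (dropSums m as)

∈-dropSums⁻ : ∀ m as {v} → v ∈ dropSums m as → DropSum m as v
∈-dropSums⁻ zero [] (here refl) = nil
∈-dropSums⁻ zero (a ∷ as) v∈ with ∈-++⁻ (dropSums 0 as) v∈
... | inj₁ v∈₀ = zer (∈-dropSums⁻ 0 as v∈₀)
... | inj₂ v∈₂ with ∈-map⁻ (2 * a +_) v∈₂
...   | w , w∈ , refl = two (∈-dropSums⁻ 0 as w∈)
∈-dropSums⁻ (suc m) (a ∷ as) v∈ with ∈-++⁻ (dropSums (suc m) as ++ map (2 * a +_) (dropSums (suc m) as)) v∈
... | inj₂ v∈₁ with ∈-map⁻ (a +_) v∈₁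
...   | w , w∈ , refl = one (∈-dropSums⁻ m as w∈)
∈-dropSums⁻ (suc m) (a ∷ as) v∈ | inj₁ v∈₀₂ with ∈-++⁻ (dropSums (suc m) as) v∈₀₂
... | inj₁ v∈₀ = zer (∈-dropSums⁻ (suc m) as v∈₀)
... | inj₂ v∈₂ with ∈-map⁻ (2 * a +_) v∈₂
...   | w , w∈ , refl = two (∈-dropSums⁻ (suc m) as w∈)

-- Omitting the new largest element covers all t < k²; taking it twice shifts this range by 2k + 1,
-- up to (k + 1)². No gap arises because 2k + 1 ≤ k². The case of four elements is computed.
odds-dropSum : ∀ d n {t} → t < (4 + n) * (4 + n) → DropSum 1 (odds d (4 + n)) (d * (2 * t + 1))
odds-dropSum d zero t< =
  dropSum-scale d 4 (∈-dropSums⁻ 1 (odds 1 4) (All.lookup table (∈-upTo⁺ t<)))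
  where
  table : All (λ t → 2 * t + 1 ∈ dropSums 1 (odds 1 4)) (upTo 16)
  table = from-yes (all? (λ t → 2 * t + 1 ∈? dropSums 1 (odds 1 4)) (upTo 16))
odds-dropSum d (suc n) {t} t< with t <? (4 + n) * (4 + n)
... | yes t<k² = zer (odds-dropSum d n t<k²)
... | no t≮k² = subst (DropSum 1 _) value (two (odds-dropSum d n t′<))
  where
  k = 4 + n
  t′ = t ∸ (2 * k + 1)
  t≡ : (2 * k + 1) + t′ ≡ t
  t≡ = m+[n∸m]≡n (linear (n * n + 6 * n + 7) (≮⇒≥ t≮k²) (identity n t))
    where
    identity : ∀ n t → (2 * (4 + n) + 1) + t + (n * n + 6 * n + 7) ≡ t + (4 + n) * (4 + n)
    identity = solve-∀
  t′< : t′ < k * k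
  t′< = linear 0 (t< ⊕ eq≤ t≡) (identity n t t′)
    where
    identity : ∀ n t t′ → suc t′ + ((5 + n) * (5 + n) + t) + 0 ≡ (4 + n) * (4 + n) + (suc t + ((2 * (4 + n) + 1) + t′))
    identity = solve-∀
  value : 2 * (d * (2 * k + 1)) + d * (2 * t′ + 1) ≡ d * (2 * t + 1)
  value = ≡-trans (identity d k t′) (cong (λ t → d * (2 * t + 1)) t≡)
    where
    identity : ∀ d k t′ → 2 * (d * (2 * k + 1)) + d * (2 * t′ + 1) ≡ d * (2 * ((2 * k + 1) + t′) + 1)
    identity = solve-∀

-- Omitting one element

module ThreeElements (a b c : ℕ) (0<a : 0 < a) (a<b : a < b) (b<c : b < c) where

  private
    A : List ℕ
    A = c ∷ b ∷ a ∷ []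
    c∈ : c ∈ A
    c∈ = here refl
    b∈ : b ∈ A
    b∈ = there (here refl)
    a∈ : a ∈ A
    a∈ = there (there (here refl))
    Below : ℕ → Set
    Below v = DropSum 1 A v × v < c + (b + (a + 0))

    a-below : Below a
    a-below = dropSum-single a∈ , linear (c + a) a<b (solve (a ▸ b ▸ c ▸ ε))
    b-below : Below b
    b-below = dropSum-single b∈ , linear (a + b) b<c (solve (a ▸ b ▸ c ▸ ε))
    c-below : Below c
    c-below = dropSum-single c∈ , linear (a + a) a<b (solve (a ▸ b ▸ c ▸ ε))
    b+2a-below : Below (b + 2 * a)
    b+2a-below = dropSum-pair b∈ a∈ (λ b≡a → <⇒≢ a<b (sym b≡a)) ,
                 linear 1 (a<b ⊕ b<c) (solve (a ▸ b ▸ c ▸ ε))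
    a+2b-below : Below (a + 2 * b)
    a+2b-below = dropSum-pair a∈ b∈ (<⇒≢ a<b) , linear 0 b<c (solve (a ▸ b ▸ c ▸ ε))
    c+2a-below : Below (c + 2 * a)
    c+2a-below = dropSum-pair c∈ a∈ (λ c≡a → <⇒≢ (<-trans a<b b<c) (sym c≡a)) ,
                 linear 0 a<b (solve (a ▸ b ▸ c ▸ ε))

    q<q+2a : ∀ q → q < q + 2 * a
    q<q+2a q = linear a 0<a (solve (q ▸ a ▸ ε))
    b+2a<a+2b : b + 2 * a < a + 2 * b
    b+2a<a+2b = linear 0 a<b (solve (a ▸ b ▸ ε))
    b+2a<c+2a : b + 2 * a < c + 2 * a
    b+2a<c+2a = +-monoˡ-< (2 * a) b<c

    -- If `a + 2 * b` and `c + 2 * a` coincide, `c` makes up for the loss unless it equals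
    -- `b + 2 * a`; the two equations together give b = 3a and c = 5a.
    five-below : IsOdds A ⊎ AtLeast 5 Below
    five-below with <-cmp (a + 2 * b) (c + 2 * a)
    ... | tri< lt _ _ = inj₂ (atLeast-chain (a ∷ b ∷ b + 2 * a ∷ a + 2 * b ∷ c + 2 * a ∷ [])
      (a<b ∷ q<q+2a b ∷ b+2a<a+2b ∷ lt ∷ [-])
      (a-below ∷ b-below ∷ b+2a-below ∷ a+2b-below ∷ c+2a-below ∷ []))
    ... | tri> _ _ gt = inj₂ (atLeast-chain (a ∷ b ∷ b + 2 * a ∷ c + 2 * a ∷ a + 2 * b ∷ [])
      (a<b ∷ q<q+2a b ∷ b+2a<c+2a ∷ gt ∷ [-])
      (a-below ∷ b-below ∷ b+2a-below ∷ c+2a-below ∷ a+2b-below ∷ []))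
    ... | tri≈ _ eq _ with <-cmp c (b + 2 * a)
    ...   | tri< lt _ _ = inj₂ (atLeast-chain (a ∷ b ∷ c ∷ b + 2 * a ∷ a + 2 * b ∷ [])
      (a<b ∷ b<c ∷ lt ∷ b+2a<a+2b ∷ [-])
      (a-below ∷ b-below ∷ c-below ∷ b+2a-below ∷ a+2b-below ∷ []))
    ...   | tri> _ _ gt = inj₂ (atLeast-chain (a ∷ b ∷ b + 2 * a ∷ c ∷ a + 2 * b ∷ [])
      (a<b ∷ q<q+2a b ∷ gt ∷ subst (c <_) (sym eq) (q<q+2a c) ∷ [-])
      (a-below ∷ b-below ∷ b+2a-below ∷ c-below ∷ a+2b-below ∷ []))
    ...   | tri≈ _ eq′ _ = inj₁ (a , 3 , cong₂ _∷_ c≡ (cong₂ _∷_ b≡ (cong (_∷ []) a≡)))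
      where
      a≡ : a ≡ a * 1
      a≡ = sym (*-identityʳ a)
      b≡ : b ≡ a * 3
      b≡ = ≤-antisym (linear 0 (eq≤ eq ⊕ eq≤ eq′) (solve (a ▸ b ▸ c ▸ ε)))
                     (linear 0 (eq≥ eq ⊕ eq≥ eq′) (solve (a ▸ b ▸ c ▸ ε)))
      c≡ : c ≡ a * 5
      c≡ = ≡-trans eq′ (≡-trans (cong (_+ 2 * a) b≡) (solve (a ▸ ε)))

  three-elements : IsOdds A ⊎ AtLeast 10 (DropSum 1 A)
  three-elements with five-below
  ... | inj₁ isOdds = inj₁ isOdds
  -- The sums in `Below` lie under the centre `sum A` of the reflection, so their mirror images are
  -- five further sums.
  ... | inj₂ five = inj₂ (atLeast-⊆ (λ { (inj₁ (s , _)) → s ; (inj₂ (s , _)) → s })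
    (atLeast-∪ disjoint five (atLeast-reflect five)))
    where
    disjoint : ∀ {v} → Below v → DropSum 1 A v × 2 * sum A < v + sum A → ⊥
    disjoint {v} (_ , v<) (_ , <v) = 1≰0 (linear 1 (v< ⊕ <v) (identity v (sum A)))
      where
      identity : ∀ v S → 1 + (S + (v + S)) + 1 ≡ 0 + (suc v + suc (2 * S))
      identity = solve-∀

-- Adding a new largest element to the odd multiples of d

odd-multiple? : ∀ d x → 0 < d → (∃ λ u → x ≡ d * (2 * u + 1)) ⊎ ¬ (2 * d ∣ x + d)
odd-multiple? d x 0<d with 2 * d ∣? x + d
... | no ∤ = inj₂ ∤
... | yes (divides zero eq) = ⊥-elim (<⇒≢ (≤-trans 0<d (m≤n+m d x)) (sym eq))
... | yes (divides (suc u) eq) = inj₁ (u , +-cancelʳ-≡ d _ _ (≡-trans eq (identity d u)))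
  where
  identity : ∀ d u → suc u * (2 * d) ≡ d * (2 * u + 1) + d
  identity = solve-∀

odd-multiple-injective : ∀ {d s t} → 0 < d → d * (2 * s + 1) ≡ d * (2 * t + 1) → s ≡ t
odd-multiple-injective {suc d} _ eq =
  *-cancelˡ-≡ _ _ 2 (+-cancelʳ-≡ 1 _ _ (*-cancelˡ-≡ _ _ (suc d) eq))

odds-square : ∀ {d} n → 0 < d → AtLeast ((4 + n) * (4 + n)) (DropSum 1 (odds d (4 + n)))
odds-square {d} n 0<d =
  atLeast-range _ (λ t → d * (2 * t + 1)) (odd-multiple-injective 0<d) (odds-dropSum d n)

module Extension (d x : ℕ) (0<d : 0 < d) where

  private instance
    d≢0 : NonZero d
    d≢0 = >-nonZero 0<d

  odd-injective : ∀ {s t} → d * (2 * s + 1) ≡ d * (2 * t + 1) → s ≡ t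
  odd-injective = odd-multiple-injective 0<d

  even-injective : ∀ {i j} → x + d * (2 * i) ≡ x + d * (2 * j) → i ≡ j
  even-injective eq = *-cancelˡ-≡ _ _ 2 (*-cancelˡ-≡ _ _ d (+-cancelˡ-≡ x _ _ eq))

  odd-below : ∀ {J t} → d * (2 * J + 1) ≤ x → t ≤ 2 * J → d * (2 * t + 1) < 2 * x + d
  odd-below {J} {t} ≤x t≤ =
    linear 1 (≤x ⊕ ≤x ⊕ *-monoʳ-≤ d t≤ ⊕ *-monoʳ-≤ d t≤ ⊕ 0<d ⊕ 0<d) (identity d J t x)
    where
    identity : ∀ d J t x → suc (d * (2 * t + 1)) + (x + (x + (d * (2 * J) + (d * (2 * J) + (d + d))))) + 1 ≡
               2 * x + d + (d * (2 * J + 1) + (d * (2 * J + 1) + (d * t + (d * t + (1 + 1)))))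
    identity = solve-∀

  -- The strict hypothesis on `x` admits one more index, t = 2J + 1.
  odd-below′ : ∀ {J t} → d * (2 * J + 1) < x → t ≤ 2 * J + 1 → d * (2 * t + 1) < 2 * x + d
  odd-below′ {J} {t} <x t≤ =
    linear 1 (<x ⊕ <x ⊕ *-monoʳ-≤ d t≤ ⊕ *-monoʳ-≤ d t≤) (identity d J t x)
    where
    identity : ∀ d J t x → suc (d * (2 * t + 1)) + (x + (x + (d * (2 * J + 1) + d * (2 * J + 1)))) + 1 ≡
               2 * x + d + (suc (d * (2 * J + 1)) + (suc (d * (2 * J + 1)) + (d * t + d * t)))
    identity = solve-∀

  -- Coefficient 1 at `x` leaves an even multiple of `d`, so these sums avoid those with coefficient
  -- 0 or 2 at `x`.
  module NotOddMultiple (∤ : ¬ (2 * d ∣ x + d)) where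

    x+even≢odd : ∀ j t → x + d * (2 * j) ≢ d * (2 * t + 1)
    x+even≢odd j t eq = ∤ (∣m+n∣m⇒∣n (divides (suc t) (begin
      j * (2 * d) + (x + d)    ≡⟨ identity d j x ⟩
      x + d * (2 * j) + d      ≡⟨ cong (_+ d) eq ⟩
      d * (2 * t + 1) + d      ≡⟨ identity′ d t ⟩
      suc t * (2 * d)          ∎)) (n∣m*n j))
      where
      open ≡-Reasoning
      identity : ∀ d j x → j * (2 * d) + (x + d) ≡ x + d * (2 * j) + d
      identity = solve-∀
      identity′ : ∀ d t → d * (2 * t + 1) + d ≡ suc t * (2 * d)
      identity′ = solve-∀

    x+even≢2x+odd : ∀ j t → x + d * (2 * j) ≢ 2 * x + d * (2 * t + 1)
    x+even≢2x+odd j t eq = ∤ (∣m+n∣m⇒∣n (divides j (+-cancelˡ-≡ x _ _ (begin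
      x + (t * (2 * d) + (x + d))  ≡⟨ identity d t x ⟩
      2 * x + d * (2 * t + 1)      ≡⟨ eq ⟨
      x + d * (2 * j)              ≡⟨ identity′ d j x ⟩
      x + j * (2 * d)              ∎))) (n∣m*n t))
      where
      open ≡-Reasoning
      identity : ∀ d t x → x + (t * (2 * d) + (x + d)) ≡ 2 * x + d * (2 * t + 1)
      identity = solve-∀
      identity′ : ∀ d j x → x + d * (2 * j) ≡ x + j * (2 * d)
      identity′ = solve-∀

  InWindow : ℕ → ℕ → Set
  InWindow K v = DropSum 1 (x ∷ odds d K) v × v < 2 * x + d

  next-odd : ∀ K u → x ≡ d * (2 * u + 1) → u ≡ K → IsOdds (x ∷ odds d K)
  next-odd K u x≡ refl = d , suc K , cong (_∷ odds d K) x≡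

  beyond : ∀ {J u} → d * (2 * J + 1) < x → x ≡ d * (2 * u + 1) → u ≢ suc J → 2 + J ≤ u
  beyond {J} {u} <x refl u≢ =
    ≤∧≢⇒< (*-cancelˡ-< 2 J u (+-cancelʳ-< 1 (2 * J) (2 * u) (*-cancelˡ-< d _ _ <x))) (u≢ ∘ sym)

  odd-mono : ∀ {i j} → i ≤ j → d * (2 * i + 1) ≤ d * (2 * j + 1)
  odd-mono i≤j = *-monoʳ-≤ d (+-monoˡ-≤ 1 (*-monoʳ-≤ 2 i≤j))

  extend-long : ∀ n → d * (2 * (3 + n) + 1) < x →
                IsOdds (x ∷ odds d (4 + n)) ⊎ AtLeast ((5 + n) * (5 + n) + 1) (DropSum 1 (x ∷ odds d (4 + n)))
  extend-long n <x with odd-multiple? d x 0<d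
  ... | inj₁ (u , x≡) with u ≟ 4 + n
  ...   | yes u≡ = inj₁ (next-odd (4 + n) u x≡ u≡)
  -- With K = 4 + n, now x ≥ d(2K + 3), and 2K + 2 odd multiples fit below 2x + d, one more than the
  -- difference of (K + 1)² and K².
  ...   | no u≢ = inj₂ (atLeast-≤ (≤-reflexive (identity n)) (stack (odds-≥ d (4 + n)) (odds-square n 0<d)
    (atLeast-range (2 * (5 + n)) (λ t → d * (2 * t + 1)) odd-injective (λ t< →
      zer (odds-dropSum d n (<-≤-trans t< bound)) ,
      odd-below {5 + n} (subst (d * (2 * (5 + n) + 1) ≤_) (sym x≡) (odd-mono (beyond <x x≡ u≢))) (<⇒≤ t<)))))
    where
    identity : ∀ n → (5 + n) * (5 + n) + 1 ≡ 2 * (5 + n) + (4 + n) * (4 + n)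
    identity = solve-∀
    bound : 2 * (5 + n) ≤ (4 + n) * (4 + n)
    bound = linear (n * n + 6 * n + 6) (≤-refl {0}) (identity′ n)
      where
      identity′ : ∀ n → 2 * (5 + n) + 0 + (n * n + 6 * n + 6) ≡ (4 + n) * (4 + n) + 0
      identity′ = solve-∀
  -- The window holds 2K odd multiples of `d`, where K = 4 + n, and the two sums x and x + 2d.
  extend-long n <x | inj₂ ∤ =
    inj₂ (atLeast-≤ (≤-reflexive (identity n)) (stack (odds-≥ d (4 + n)) (odds-square n 0<d)
      (atLeast-⊆ (λ { (inj₁ (_ , w)) → w ; (inj₂ (_ , w)) → w })
        (atLeast-∪ {P = λ v → (∃ λ t → v ≡ d * (2 * t + 1)) × InWindow (4 + n) v}
                   {Q = λ v → (∃ λ j → v ≡ x + d * (2 * j)) × InWindow (4 + n) v}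
          (λ { ((t , eq) , _) ((j , eq′) , _) → x+even≢odd j t (≡-trans (sym eq′) eq) })
          (atLeast-range (2 * (4 + n)) (λ t → d * (2 * t + 1)) odd-injective (λ {t} t< →
            (t , refl) , zer (odds-dropSum d n (<-≤-trans t< bound)) ,
            odd-below′ {3 + n} <x (≤-pred (subst (t <_) (identity″ n) t<))))
          (atLeast-range 2 (λ j → x + d * (2 * j)) even-injective (λ {j} j<2 →
            (j , refl) , one (dropSum-scale d (4 + n) (doubles j<2)) , x+even-below j<2))))))
    where
    open NotOddMultiple ∤
    identity : ∀ n → (5 + n) * (5 + n) + 1 ≡ 2 * (4 + n) + 2 + (4 + n) * (4 + n)
    identity = solve-∀
    identity″ : ∀ n → 2 * (4 + n) ≡ suc (2 * (3 + n) + 1)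
    identity″ = solve-∀
    bound : 2 * (4 + n) ≤ (4 + n) * (4 + n)
    bound = *-monoˡ-≤ (4 + n) {2} {4 + n} (s≤s (s≤s z≤n))
    1∈odds : ∀ n → 1 ∈ odds 1 (suc n)
    1∈odds zero = here refl
    1∈odds (suc n) = there (1∈odds n)
    doubles : ∀ {j} → j < 2 → DropSum 0 (odds 1 (4 + n)) (2 * j)
    doubles {0} _ = dropSum-0 _
    doubles {1} _ = dropSum-double (1∈odds (3 + n))
    doubles {suc (suc _)} (s≤s (s≤s ()))
    x+even-below : ∀ {j} → j < 2 → x + d * (2 * j) < 2 * x + d
    x+even-below {j} j<2 = linear (d * 2 * n + 6 * d) (<x ⊕ *-monoʳ-≤ d j<2 ⊕ *-monoʳ-≤ d j<2) (identity‴ d j n x)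
      where
      identity‴ : ∀ d j n x → suc (x + d * (2 * j)) + (x + (d * 2 + d * 2)) + (d * 2 * n + 6 * d) ≡
                  2 * x + d + (suc (d * (2 * (3 + n) + 1)) + (d * suc j + d * suc j))
      identity‴ = solve-∀

  -- 9 is the one odd number up to 17 that is no DropSum 1 of 5, 3, 1.
  private
    T₈ T₅ J₄ : List ℕ
    T₈ = 0 ∷ 1 ∷ 2 ∷ 3 ∷ 5 ∷ 6 ∷ 7 ∷ 8 ∷ []
    T₅ = 0 ∷ 1 ∷ 2 ∷ 3 ∷ 5 ∷ []
    J₄ = 0 ∷ 1 ∷ 3 ∷ 5 ∷ []

    T₈-dropSum : ∀ {t} → t ∈ T₈ → DropSum 1 (odds d 3) (d * (2 * t + 1))
    T₈-dropSum t∈ = dropSum-scale d 3 (∈-dropSums⁻ 1 (odds 1 3) (All.lookup table t∈))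
      where
      table : All (λ t → 2 * t + 1 ∈ dropSums 1 (odds 1 3)) T₈
      table = from-yes (all? (λ t → 2 * t + 1 ∈? dropSums 1 (odds 1 3)) T₈)

    J₄-dropSum : ∀ {j} → j ∈ J₄ → DropSum 0 (odds d 3) (d * (2 * j))
    J₄-dropSum j∈ = dropSum-scale d 3 (∈-dropSums⁻ 0 (odds 1 3) (All.lookup table j∈))
      where
      table : All (λ j → 2 * j ∈ dropSums 0 (odds 1 3)) J₄
      table = from-yes (all? (λ j → 2 * j ∈? dropSums 0 (odds 1 3)) J₄)

    T₈≤8 : ∀ {t} → t ∈ T₈ → t ≤ 8
    T₈≤8 = All.lookup (from-yes (all? (_≤? 8) T₈))

    T₅≤5 : ∀ {t} → t ∈ T₅ → t ≤ 5
    T₅≤5 = All.lookup (from-yes (all? (_≤? 5) T₅))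

    T₅⊆T₈ : ∀ {t} → t ∈ T₅ → t ∈ T₈
    T₅⊆T₈ = All.lookup (from-yes (all? (_∈? T₈) T₅))

    members : ∀ L → Unique L → AtLeast (length L) (_∈ L)
    members L uL = L , uL , All.tabulate id , ≤-refl

    eight : AtLeast 8 (DropSum 1 (odds d 3))
    eight = atLeast-map (λ t → d * (2 * t + 1)) odd-injective T₈-dropSum (members T₈ (from-yes (unique? T₈)))

  extend-three : d * (2 * 2 + 1) < x → IsOdds (x ∷ odds d 3) ⊎ AtLeast 17 (DropSum 1 (x ∷ odds d 3))
  extend-three <x with odd-multiple? d x 0<d
  ... | inj₁ (u , x≡) with u ≟ 3
  ...   | yes u≡ = inj₁ (next-odd 3 u x≡ u≡)
  ...   | no u≢ = inj₂ (stack {m = 9} (odds-≥ d 3) eight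
    (atLeast-⊆ (λ { (inj₁ (_ , _ , _ , w)) → w ; (inj₂ (_ , _ , _ , w)) → w })
      (atLeast-∪ {P = λ v → ∃ λ t → t ∈ T₈ × v ≡ d * (2 * t + 1) × InWindow 3 v}
                 {Q = λ v → ∃ λ t → t ∉ T₈ × v ≡ d * (2 * t + 1) × InWindow 3 v}
        (λ { (s , s∈ , refl , _) (t , t∉ , eq , _) → t∉ (subst (_∈ T₈) (odd-injective eq) s∈) })
        (atLeast-map (λ t → d * (2 * t + 1)) odd-injective
          (λ {t} t∈ → t , t∈ , refl , zer (T₈-dropSum t∈) , odd-below {4} 9d≤x (T₈≤8 t∈))
          (members T₈ (from-yes (unique? T₈))))
        ninth)))
    where
    4≤u : 4 ≤ u
    4≤u = beyond {2} <x x≡ u≢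
    9d≤x : d * (2 * 4 + 1) ≤ x
    9d≤x = subst (d * 9 ≤_) (sym x≡) (odd-mono 4≤u)
    Ninth : ℕ → Set
    Ninth v = ∃ λ t → t ∉ T₈ × v ≡ d * (2 * t + 1) × InWindow 3 v
    -- If x = 9d, then `x` fills the gap in `T₈`; otherwise x + 10d has index u + 5, beyond the
    -- largest index 8.
    ninth : AtLeast 1 Ninth
    ninth with u ≟ 4
    ... | yes u≡4 = singleton {Ninth} x (4 , 4∉ , ≡-trans x≡ (cong (λ u → d * (2 * u + 1)) u≡4) , dropSum-single (here refl) , x<)
      where
      4∉ : 4 ∉ T₈
      4∉ = from-yes (¬? (4 ∈? T₈))
      x< : x < 2 * x + d
      x< = linear x 0<d (solve (x ▸ d ▸ ε))
    ... | no u≢4 = singleton {Ninth} (x + d * (2 * 5)) (u + 5 , u+5∉ ,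
      ≡-trans (cong (_+ d * (2 * 5)) x≡) (identity d u) ,
      one (J₄-dropSum (there (there (there (here refl))))) ,
      x+10d<)
      where
      5≤u : 5 ≤ u
      5≤u = ≤∧≢⇒< 4≤u (u≢4 ∘ sym)
      11d≤x : d * (2 * 5 + 1) ≤ x
      11d≤x = subst (d * 11 ≤_) (sym x≡) (odd-mono 5≤u)
      u+5∉ : u + 5 ∉ T₈
      u+5∉ ∈T₈ = 1≰0 (linear 1 (5≤u ⊕ T₈≤8 ∈T₈) (solve (u ▸ ε)))
      x+10d< : x + d * (2 * 5) < 2 * x + d
      x+10d< = linear d (11d≤x ⊕ 0<d) (solve (x ▸ d ▸ ε))
      identity : ∀ d u → d * (2 * u + 1) + d * (2 * 5) ≡ d * (2 * (u + 5) + 1)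
      identity = solve-∀
  -- Coefficients 0, 1, 2 at `x` contribute 5, 4 and 8 sums, 17 in all.
  extend-three <x | inj₂ ∤ = inj₂ (atLeast-⊆ collect
    (atLeast-∪ {P = Low} {Q = λ v → Mid v ⊎ High v}
      (λ { (s , eq , _) (inj₁ (j , eq′ , _)) → x+even≢odd j s (≡-trans (sym eq′) eq)
         ; (_ , _ , _ , v<) (inj₂ (t , refl , _)) → <⇒≱ v< (+-monoʳ-≤ (2 * x) (All.head (odds-≥ d (suc t)))) })
      (atLeast-map (λ t → d * (2 * t + 1)) odd-injective
        (λ {t} t∈ → t , refl , zer (T₈-dropSum (T₅⊆T₈ t∈)) , odd-below′ {2} <x (T₅≤5 t∈))
        (members T₅ (from-yes (unique? T₅))))
      (atLeast-∪ {P = Mid} {Q = High}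
        (λ { (j , refl , _) (t , eq , _) → x+even≢2x+odd j t eq })
        (atLeast-map (λ j → x + d * (2 * j)) even-injective
          (λ {j} j∈ → j , refl , one (J₄-dropSum j∈))
          (members J₄ (from-yes (unique? J₄))))
        (atLeast-map (λ t → 2 * x + d * (2 * t + 1)) (odd-injective ∘ +-cancelˡ-≡ (2 * x) _ _)
          (λ {t} t∈ → t , refl , two (T₈-dropSum t∈))
          (members T₈ (from-yes (unique? T₈)))))))
    where
    open NotOddMultiple ∤
    Low Mid High : ℕ → Set
    Low v = ∃ λ t → v ≡ d * (2 * t + 1) × InWindow 3 v
    Mid v = ∃ λ j → v ≡ x + d * (2 * j) × DropSum 1 (x ∷ odds d 3) v
    High v = ∃ λ t → v ≡ 2 * x + d * (2 * t + 1) × DropSum 1 (x ∷ odds d 3) v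
    collect : ∀ {v} → Low v ⊎ (Mid v ⊎ High v) → DropSum 1 (x ∷ odds d 3) v
    collect (inj₁ (_ , _ , s , _)) = s
    collect (inj₂ (inj₁ (_ , _ , s))) = s
    collect (inj₂ (inj₂ (_ , _ , s))) = s

odds-extend : ∀ n d x → d * (2 * (2 + n) + 1) < x → 0 < d * (2 * (2 + n) + 1) →
              IsOdds (x ∷ odds d (3 + n)) ⊎ AtLeast ((4 + n) * (4 + n) + 1) (DropSum 1 (x ∷ odds d (3 + n)))
odds-extend zero (suc d) x <x _ = Extension.extend-three (suc d) x z<s <x
odds-extend (suc n) (suc d) x <x _ = Extension.extend-long (suc d) x z<s n <x

-- Induction by removing the largest element: a surplus over (k - 1)² persists, because the window
-- adds 2k - 1; only an extremal rest needs the separate argument `odds-extend`.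
omit-one : ∀ n as → length as ≡ 3 + n → Descending as → All (0 <_) as →
           IsOdds as ⊎ AtLeast ((3 + n) * (3 + n) + 1) (DropSum 1 as)
omit-one zero (c ∷ b ∷ a ∷ []) _ ((b<c ∷ _ ∷ []) ∷ (a<b ∷ []) ∷ _) (_ ∷ _ ∷ 0<a ∷ []) =
  ThreeElements.three-elements a b c 0<a a<b b<c
omit-one (suc n) (x ∷ as) len (<x ∷ desc) (_ ∷ 0<as) with omit-one n as (suc-injective len) desc 0<as
... | inj₁ (d , k , refl) with ≡-trans (sym (length-odds d k)) (suc-injective len)
...   | refl = odds-extend n d x (All.head <x) (All.head 0<as)
omit-one (suc n) (x ∷ as) len desc (_ ∷ 0<as) | inj₂ many with initLast as
... | M ∷ʳ′ a = inj₂ (atLeast-≤ (≤-reflexive count≡) (stack (All.tabulate (a≤ ∘ there)) many (window 2≤M)))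
  where
  0<a : 0 < a
  0<a = All.lookup 0<as (∈-++⁺ʳ M (here refl))
  open Window x a M desc 0<a using (A; window; a≤)
  |M| : length M ≡ 2 + n
  |M| = +-cancelʳ-≡ 1 _ _ (≡-trans (sym (length-++ M)) (≡-trans (suc-injective len) (cong suc (cong suc (+-comm 1 n)))))
  2≤M : 2 ≤ length M
  2≤M = subst (2 ≤_) (sym |M|) (s≤s (s≤s z≤n))
  count≡ : (4 + n) * (4 + n) + 1 ≡ length A + (1 + length M) + ((3 + n) * (3 + n) + 1)
  count≡ rewrite suc-injective len | |M| = identity n
    where
    identity : ∀ n → (4 + n) * (4 + n) + 1 ≡ suc (3 + n) + (1 + (2 + n)) + ((3 + n) * (3 + n) + 1)
    identity = solve-∀

-- Omitting several elements

-- Some entry has coefficient 0 or 2; making it 1 adds or subtracts a number below `a`.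
raise : ∀ {m as v a} → All (a >_) as → DropSum m as v → m < length as →
        ∃ λ w → DropSum (suc m) as w × w ≤ a + v
raise (b<a ∷ _) (zer {v = v} s) _ = _ , one s , +-monoˡ-≤ v (<⇒≤ b<a)
raise {a = a} (b<a ∷ _) (two {a = b} {v = v} s) _ =
  _ , one s , linear (a + b) (≤-refl {0}) (identity a b v)
  where
  identity : ∀ a b v → b + v + 0 + (a + b) ≡ a + (2 * b + v) + 0
  identity = solve-∀
raise {a = a} (_ ∷ <a) (one {a = b} {v = v} s) (s≤s m<) with raise <a s m<
... | w , t , w≤ = b + w , one t , subst (b + w ≤_) (x∙yz≈y∙xz b a v) (+-monoʳ-≤ b w≤)

dropSum-full : ∀ as → DropSum (length as) as (sum as)
dropSum-full [] = nil
dropSum-full (a ∷ as) = one (dropSum-full as)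

dropSum-full-unique : ∀ as {m v} → length as ≡ m → DropSum m as v → v ≡ sum as
dropSum-full-unique [] refl nil = refl
dropSum-full-unique (a ∷ as) refl (zer s) = ⊥-elim (<-irrefl refl (dropSum-length s))
dropSum-full-unique (a ∷ as) refl (one s) = cong (a +_) (dropSum-full-unique as refl s)
dropSum-full-unique (a ∷ as) refl (two s) = ⊥-elim (<-irrefl refl (dropSum-length s))

-- For m + h elements, `least` is the sum of the m smallest; adding one of the h others to it gives
-- the sums of `above-least`.
record Least (m h : ℕ) (as : List ℕ) : Set where
  field
    least : ℕ
    attained : DropSum m as least
    minimal : ∀ {v} → DropSum m as v → least ≤ v
    above-least : ∀ {x} → All (x >_) as → AtLeast h (λ v → DropSum (suc m) as v × v < x + least)

least-dropSum : ∀ m h as → length as ≡ m + h → Descending as → Least m h as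
least-dropSum m zero as len _ = record
  { least = sum as
  ; attained = subst (λ m → DropSum m as (sum as)) |as|≡m (dropSum-full as)
  ; minimal = λ s → ≤-reflexive (sym (dropSum-full-unique as |as|≡m s))
  ; above-least = λ _ → [] , [] , [] , z≤n
  }
  where
  |as|≡m : length as ≡ m
  |as|≡m = ≡-trans len (+-identityʳ m)
least-dropSum m (suc h) [] len _ = ⊥-elim (1+n≢0 (sym (≡-trans len (+-suc m h))))
least-dropSum m (suc h) (b ∷ bs) len (<b ∷ desc) = record
  { least = least
  ; attained = zer attained
  ; minimal = minimal′
  ; above-least = λ { {x} (b<x ∷ _) →
      atLeast-⊆ (λ { (inj₁ refl) → one attained , +-monoˡ-< least b<x
                   ; (inj₂ (s , v<)) → zer s , <-trans v< (+-monoˡ-< least b<x) })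
        (atLeast-∪ (λ { refl (_ , v<) → <-irrefl refl v< })
          (singleton {_≡ b + least} (b + least) refl) (above-least <b)) }
  }
  where
  |bs| : length bs ≡ m + h
  |bs| = suc-injective (≡-trans len (+-suc m h))
  open Least (least-dropSum m h bs |bs| desc)
  minimal′ : ∀ {v} → DropSum m (b ∷ bs) v → least ≤ v
  minimal′ (zer s) = minimal s
  minimal′ (two s) = ≤-trans (minimal s) (m≤n+m _ _)
  -- A coefficient 1 at the largest element can be traded for one further down without increasing
  -- the sum.
  minimal′ (one s) with raise <b s (subst (_ <_) (sym |bs|) (m≤m+n m h))
  ... | w , t , w≤ = ≤-trans (minimal t) w≤

-- The plain count takes the threshold `c` to be `x`; a smaller `c` confines the low and high sums
-- further and leaves room for an additional sum.
module Layers {m h : ℕ} (x : ℕ) {as : List ℕ} (L : Least m h as) (c : ℕ) (c≤x : c ≤ x) (<c : All (c >_) as) where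

  open Least L

  data Layer (v : ℕ) : Set where
    low  : DropSum (suc m) (x ∷ as) v → v < c + least → Layer v
    high : DropSum (suc m) (x ∷ as) v → 2 * sum (x ∷ as) < v + (c + least) → Layer v
    mid  : ∀ r → DropSum m as r → v ≡ x + r → Layer v

  layer-dropSum : ∀ {v} → Layer v → DropSum (suc m) (x ∷ as) v
  layer-dropSum (low s _) = s
  layer-dropSum (high s _) = s
  layer-dropSum (mid r s refl) = one s

  mid-bounds : ∀ {r} → DropSum m as r → c + least ≤ x + r × (x + r) + (c + least) ≤ 2 * sum (x ∷ as)
  mid-bounds {r} s with dropSum-reflect s
  ... | r′ , s′ , eq = +-mono-≤ c≤x (minimal s) ,
    linear 0 (c≤x ⊕ minimal s′ ⊕ eq≤ eq) (identity x r c least r′ (sum as))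
    where
    identity : ∀ x r c s r′ S → (x + r) + (c + s) + (x + (r′ + 2 * S)) + 0 ≡ 2 * (x + S) + (c + (s + (r + r′)))
    identity = solve-∀

  layers : ∀ {n} → AtLeast n (DropSum m as) → AtLeast (h + (h + n)) Layer
  layers many = atLeast-⊆ collect
    (atLeast-∪ low-disjoint lows
      (atLeast-∪ high-disjoint (atLeast-reflect lows)
        (atLeast-map {Q = λ v → ∃ λ r → DropSum m as r × v ≡ x + r} (x +_)
          (+-cancelˡ-≡ x _ _) (λ {r} s → r , s , refl) many)))
    where
    Low High Mid : ℕ → Set
    Low v = DropSum (suc m) (x ∷ as) v × v < c + least
    High v = DropSum (suc m) (x ∷ as) v × 2 * sum (x ∷ as) < v + (c + least)
    Mid v = ∃ λ r → DropSum m as r × v ≡ x + r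
    lows : AtLeast h Low
    lows = atLeast-⊆ (λ { (s , v<) → zer s , v< }) (above-least <c)
    high-disjoint : ∀ {v} → High v → Mid v → ⊥
    high-disjoint (_ , <v) (r , s , refl) = <⇒≱ <v (proj₂ (mid-bounds s))
    low-disjoint : ∀ {v} → Low v → High v ⊎ Mid v → ⊥
    low-disjoint {v} (_ , v<) (inj₁ (_ , <v)) = <-irrefl refl (begin-strict
      2 * sum (x ∷ as)              <⟨ <v ⟩
      v + (c + least)               ≤⟨ +-monoˡ-≤ (c + least) (<⇒≤ v<) ⟩
      (c + least) + (c + least)     ≤⟨ +-monoˡ-≤ (c + least) (proj₁ (mid-bounds attained)) ⟩
      (x + least) + (c + least)     ≤⟨ proj₂ (mid-bounds attained) ⟩
      2 * sum (x ∷ as)              ∎)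
      where open ≤-Reasoning
    low-disjoint (_ , v<) (inj₂ (r , s , refl)) = <⇒≱ v< (proj₁ (mid-bounds s))
    collect : ∀ {v} → Low v ⊎ (High v ⊎ Mid v) → Layer v
    collect (inj₁ (s , v<)) = low s v<
    collect (inj₂ (inj₁ (s , <v))) = high s <v
    collect (inj₂ (inj₂ (r , s , eq))) = mid r s eq

-- Odd multiples with several coefficients 1

sum-odds : ∀ d n → sum (odds d n) ≡ d * (n * n)
sum-odds d zero = sym (*-zeroʳ d)
sum-odds d (suc n) = ≡-trans (cong (d * (2 * n + 1) +_) (sum-odds d n)) (identity d n)
  where
  identity : ∀ d n → d * (2 * n + 1) + d * (n * n) ≡ d * (suc n * suc n)
  identity = solve-∀

odds-pad : ∀ {d n m v} j → DropSum m (odds d n) v → DropSum m (odds d (j + n)) v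
odds-pad zero s = s
odds-pad (suc j) s = zer (odds-pad j s)

odds-full : ∀ d n → DropSum n (odds d n) (d * (n * n))
odds-full d n = subst₂ (λ k v → DropSum k (odds d n) v) (length-odds d n) (sum-odds d n) (dropSum-full (odds d n))

-- The m smallest odd numbers add up to m², and parity does the rest. A new coefficient 1 sits at an
-- odd number at least 2m + 1 = (m + 1)² - m².
odds-form : ∀ {m} d n {v} → DropSum m (odds d n) v → ∃ λ t → v ≡ d * (m * m + 2 * t)
odds-form d zero nil = 0 , sym (*-zeroʳ d)
odds-form d (suc n) (zer s) = odds-form d n s
odds-form {m} d (suc n) (two s) with odds-form d n s
... | t , refl = (2 * n + 1) + t , identity d n m t
  where
  identity : ∀ d n m t → 2 * (d * (2 * n + 1)) + d * (m * m + 2 * t) ≡ d * (m * m + 2 * ((2 * n + 1) + t))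
  identity = solve-∀
odds-form d (suc n) (one {m} s) with odds-form d n s | m≤n⇒∃[o]m+o≡n (subst (m ≤_) (length-odds d n) (dropSum-length s))
... | t , refl | j , refl = j + t , identity d m j t
  where
  identity : ∀ d m j t → d * (2 * (m + j) + 1) + d * (m * m + 2 * t) ≡ d * (suc m * suc m + 2 * (j + t))
  identity = solve-∀

odds-≤ : ∀ d n → All (d * (2 * n + 1) ≥_) (odds d (suc n))
odds-≤ d zero = ≤-refl ∷ []
odds-≤ d (suc n) = ≤-refl ∷ All.map (λ q≤ → ≤-trans q≤ step) (odds-≤ d n)
  where
  step : d * (2 * n + 1) ≤ d * (2 * suc n + 1)
  step = *-monoʳ-≤ d (+-monoˡ-≤ 1 (*-monoʳ-≤ 2 (n≤1+n n)))

positive-factor : ∀ {d n} → 0 < d * n → 0 < d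
positive-factor {suc d} _ = z<s

-- The rest is extremal but `x` is not the next odd multiple; a sum outside all layers then supplies
-- the surplus.
module ExtraLayer (d m h x : ℕ) (0<d : 0 < d) (<x : d * (2 * (m + (3 + h)) + 1) < x)
                  (x≢ : x ≢ d * (2 * suc (m + (3 + h)) + 1))
                  (L : Least (suc m) (3 + h) (odds d (suc (m + (3 + h))))) where

  private
    K = m + (3 + h)
    -- The smallest threshold above all remaining elements.
    c = suc (d * (2 * K + 1))

  open Least L
  open Layers x L c <x (All.map s≤s (odds-≤ d K)) public

  -- the sum of d, 3d, …, (2m − 1)d, (2m + 3)d and (2K + 1)d
  extra : ℕ
  extra = d * (suc m * suc m + 2 * suc K + 1)

  extra-dropSum : DropSum (2 + m) (odds d (suc K)) extra
  extra-dropSum = subst (DropSum (2 + m) _) (identity d m h)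
    (one (subst (λ k → DropSum (suc m) (odds d k) (d * (2 * suc m + 1) + d * (m * m))) (identity′ m h)
      (odds-pad (1 + h) (one (zer (odds-full d m))))))
    where
    identity : ∀ d m h → d * (2 * (m + (3 + h)) + 1) + (d * (2 * suc m + 1) + d * (m * m)) ≡
               d * (suc m * suc m + 2 * suc (m + (3 + h)) + 1)
    identity = solve-∀
    identity′ : ∀ m h → 1 + h + suc (suc m) ≡ m + (3 + h)
    identity′ = solve-∀

  least≤ : least ≤ d * (suc m * suc m)
  least≤ = minimal (subst (λ k → DropSum (suc m) (odds d k) (d * (suc m * suc m))) (identity m h)
                          (odds-pad (3 + h) (odds-full d (suc m))))
    where
    identity : ∀ m h → 3 + h + suc m ≡ suc (m + (3 + h))
    identity = solve-∀

  extra∉Layer : ¬ Layer extra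
  extra∉Layer (low _ <c+s) =
    1≰0 (linear d (<c+s ⊕ least≤ ⊕ 0<d) (identity d m K least))
    where
    identity : ∀ d m K s → 1 + (suc (d * (2 * K + 1)) + s + (d * (suc m * suc m) + d)) + d ≡
               0 + (suc (d * (suc m * suc m + 2 * suc K + 1)) + (s + 1))
    identity = solve-∀
  extra∉Layer (high _ <v) =
    1≰0 (linear (1 + 2 * d * (2 * suc m * (3 + h) + (8 + 6 * h + h * h)))
      (subst (λ S → 2 * (x + S) < extra + (c + least)) (sum-odds d (suc K)) <v ⊕ least≤ ⊕ <x ⊕ <x)
      (identity d m h x least))
    where
    identity : ∀ d m h x s →
      1 + (d * (suc m * suc m + 2 * suc (m + (3 + h)) + 1) + (suc (d * (2 * (m + (3 + h)) + 1)) + s)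
           + (d * (suc m * suc m) + (x + x)))
        + (1 + 2 * d * (2 * suc m * (3 + h) + (8 + 6 * h + h * h))) ≡
      0 + (suc (2 * (x + d * (suc (m + (3 + h)) * suc (m + (3 + h)))))
           + (s + (suc (d * (2 * (m + (3 + h)) + 1)) + suc (d * (2 * (m + (3 + h)) + 1)))))
    identity = solve-∀
  extra∉Layer (mid r s eq) with odds-form d (suc K) s
  -- For t = 0 the equation makes `x` the excluded next odd multiple; for t > 0 it makes x ≤ d(2K +
  -- 1).
  ... | zero , refl = x≢ (+-cancelʳ-≡ (d * (suc m * suc m + 0)) _ _
                          (≡-trans (sym eq) (identity d m (suc K))))
    where
    identity : ∀ d m K → d * (suc m * suc m + 2 * K + 1) ≡ d * (2 * K + 1) + d * (suc m * suc m + 0)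
    identity = solve-∀
  ... | suc t , refl = 1≰0 (linear (2 * d * t) (<x ⊕ eq≥ eq) (identity d m K t x))
    where
    identity : ∀ d m K t x →
      1 + (x + d * (suc m * suc m + 2 * suc K + 1)) + 2 * d * t ≡
      0 + (suc (d * (2 * K + 1)) + (x + d * (suc m * suc m + 2 * suc t)))
    identity = solve-∀

-- Every further coefficient 1 adds 2(3 + h) to the count. The weak bound is carried along because
-- over an extremal rest it fills the middle layer.
many-dropSums : ∀ m h as → length as ≡ suc m + (3 + h) → Descending as → All (0 <_) as →
  let n = 2 * suc m * (3 + h) + (3 + h) * (3 + h) + 1 in
  AtLeast n (DropSum (suc m) as) × (IsOdds as ⊎ AtLeast (suc n) (DropSum (suc m) as))
many-dropSums zero h as len desc 0<as with omit-one (suc h) as len desc 0<as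
... | inj₁ (d , k , refl) with ≡-trans (sym (length-odds d k)) len
...   | refl = atLeast-≤ (≤-reflexive (identity h)) (odds-square h (positive-factor (All.head 0<as))) , inj₁ (d , 4 + h , refl)
  where
  identity : ∀ h → 2 * 1 * (3 + h) + (3 + h) * (3 + h) + 1 ≡ (4 + h) * (4 + h)
  identity = solve-∀
many-dropSums zero h as len desc 0<as | inj₂ many =
  atLeast-≤ (n≤1+n _) many′ , inj₂ many′
  where
  identity : ∀ h → suc (2 * 1 * (3 + h) + (3 + h) * (3 + h) + 1) ≡ (4 + h) * (4 + h) + 1
  identity = solve-∀
  many′ = atLeast-≤ (≤-reflexive (identity h)) many
many-dropSums (suc m) h (x ∷ as) len (<x ∷ desc) (_ ∷ 0<as)
  with many-dropSums m h as (suc-injective len) desc 0<as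
... | many , more = atLeast-≤ (≤-reflexive (identity m h)) (step many) , strict more
  where
  n = 2 * suc m * (3 + h) + (3 + h) * (3 + h) + 1
  identity : ∀ m h → 2 * suc (suc m) * (3 + h) + (3 + h) * (3 + h) + 1 ≡
             (3 + h) + ((3 + h) + (2 * suc m * (3 + h) + (3 + h) * (3 + h) + 1))
  identity = solve-∀
  identity′ : ∀ m h → suc (2 * suc (suc m) * (3 + h) + (3 + h) * (3 + h) + 1) ≡
              (3 + h) + ((3 + h) + suc (2 * suc m * (3 + h) + (3 + h) * (3 + h) + 1))
  identity′ = solve-∀
  L : Least (suc m) (3 + h) as
  L = least-dropSum (suc m) (3 + h) as (suc-injective len) desc
  step : ∀ {n} → AtLeast n (DropSum (suc m) as) → AtLeast ((3 + h) + ((3 + h) + n)) (DropSum (2 + m) (x ∷ as))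
  step many = atLeast-⊆ layer-dropSum (layers many)
    where open Layers x L x ≤-refl <x
  strict : IsOdds as ⊎ AtLeast (suc n) (DropSum (suc m) as) →
           IsOdds (x ∷ as) ⊎ AtLeast (suc (2 * suc (suc m) * (3 + h) + (3 + h) * (3 + h) + 1)) (DropSum (2 + m) (x ∷ as))
  strict (inj₂ more) = inj₂ (atLeast-≤ (≤-reflexive (identity′ m h)) (step more))
  strict (inj₁ (d , k , refl)) with ≡-trans (sym (length-odds d k)) (suc-injective len)
  ... | refl with x ≟ d * (2 * suc (m + (3 + h)) + 1)
  ...   | yes x≡ = inj₁ (d , suc (suc (m + (3 + h))) , cong (_∷ odds d (suc (m + (3 + h)))) x≡)
  ...   | no x≢ = inj₂ (atLeast-≤ (≤-reflexive (cong suc (identity m h)))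
    (atLeast-⊆ (λ { (inj₁ refl) → zer extra-dropSum ; (inj₂ l) → layer-dropSum l })
      (atLeast-∪ (λ { refl l → extra∉Layer l }) (singleton {_≡ extra} extra refl) (layers many))))
    where open ExtraLayer d m h x (positive-factor (All.head 0<as)) (All.head <x) x≢ L

-- From signed sums of integers to DropSum

open import Defs
open import Data.Fin using (zero; suc)
import Data.Fin.Properties as Fin
open import Data.Integer as ℤ using (ℤ; +_; -[1+_]; ∣_∣)
import Data.Integer.Properties as ℤ
import Data.Integer.Tactic.RingSolver as ℤ
import Algebra.Properties.AbelianGroup ℤ.+-0-abelianGroup as ℤ-Group
open import Data.Vec as Vec using (Vec; []; _∷_; lookup; toList)
open import Function.Bundles using (_⇔_; mk⇔; Equivalence)

unique-⊆⇒length≤ : ∀ {B : Set} {xs ys : List B} → Unique xs → All (_∈ ys) xs → length xs ≤ length ys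
unique-⊆⇒length≤ [] [] = z≤n
unique-⊆⇒length≤ {xs = x ∷ xs} (x∉xs ∷ uxs) (x∈ys ∷ xs⊆ys) with ∈-∃++ x∈ys
... | as , bs , refl = ≤-trans
  (s≤s (unique-⊆⇒length≤ uxs (All.tabulate λ z∈ → remove (All.lookup x∉xs z∈) (All.lookup xs⊆ys z∈))))
  (≤-reflexive (begin
    suc (length (as ++ bs))        ≡⟨ cong suc (length-++ as) ⟩
    suc (length as + length bs)    ≡⟨ +-suc (length as) (length bs) ⟨
    length as + suc (length bs)    ≡⟨ length-++ as ⟨
    length (as ++ x ∷ bs)          ∎))
  where
  open ≡-Reasoning
  remove : ∀ {z} → x ≢ z → z ∈ as ++ x ∷ bs → z ∈ as ++ bs
  remove x≢z z∈ with ∈-++⁻ as z∈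
  ... | inj₁ z∈as = ∈-++⁺ˡ z∈as
  ... | inj₂ (here z≡x) = ⊥-elim (x≢z (sym z≡x))
  ... | inj₂ (there z∈bs) = ∈-++⁺ʳ as z∈bs

absolutes : ∀ {k} → Vec ℤ k → List ℕ
absolutes A = toList (Vec.map ∣_∣ A)

length-absolutes : ∀ {k} (A : Vec ℤ k) → length (absolutes A) ≡ k
length-absolutes [] = refl
length-absolutes (a ∷ A) = cong suc (length-absolutes A)

∈-absolutes⁻ : ∀ {k y} (A : Vec ℤ k) → y ∈ absolutes A → InAbs A y
∈-absolutes⁻ (a ∷ A) (here refl) = zero , refl
∈-absolutes⁻ (a ∷ A) (there y∈) with ∈-absolutes⁻ A y∈
... | i , eq = suc i , eq

∈-absolutes⁺ : ∀ {k y} (A : Vec ℤ k) → InAbs A y → y ∈ absolutes A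
∈-absolutes⁺ (a ∷ A) (zero , eq) = here (sym eq)
∈-absolutes⁺ (a ∷ A) (suc i , eq) = there (∈-absolutes⁺ A (i , eq))

unique-absolutes : ∀ {k} (A : Vec ℤ k) →
  (∀ i j → ∣ lookup A i ∣ ≡ ∣ lookup A j ∣ → i ≡ j) → Unique (absolutes A)
unique-absolutes [] _ = []
unique-absolutes (a ∷ A) inj =
  All.tabulate (λ y∈ a≡y → case-zero (∈-absolutes⁻ A y∈) a≡y) ∷
  unique-absolutes A (λ i j eq → Fin.suc-injective (inj (suc i) (suc j) eq))
  where
  case-zero : ∀ {y} → InAbs A y → ∣ a ∣ ≡ y → ⊥
  case-zero (i , eq) a≡y = Fin.0≢1+n (inj zero (suc i) (≡-trans a≡y (sym eq)))

-- Zero is its own negative, so disjointness excludes it.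
positive-absolutes : ∀ {k} (A : Vec ℤ k) → DisjointFromNeg A → All (0 <_) (absolutes A)
positive-absolutes A disj = All.tabulate (λ y∈ → positive (∈-absolutes⁻ A y∈))
  where
  positive : ∀ {y} → InAbs A y → 0 < y
  positive {suc y} _ = z<s
  positive {zero} (i , eq) with lookup A i | disj i i | ℤ.∣i∣≡0⇒i≡0 {lookup A i} eq
  ... | _ | a≢-a | refl = ⊥-elim (a≢-a refl)

abs-injective : ∀ {k} (A : Vec ℤ k) → Distinct A → DisjointFromNeg A →
  ∀ i j → ∣ lookup A i ∣ ≡ ∣ lookup A j ∣ → i ≡ j
abs-injective A dist disj i j eq with abs-≡ (lookup A i) (lookup A j) eq
  where
  abs-≡ : ∀ a b → ∣ a ∣ ≡ ∣ b ∣ → a ≡ b ⊎ a ≡ ℤ.- b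
  abs-≡ (+ m) (+ n) refl = inj₁ refl
  abs-≡ (+ m) -[1+ n ] refl = inj₂ refl
  abs-≡ -[1+ m ] (+ n) refl = inj₂ refl
  abs-≡ -[1+ m ] -[1+ n ] refl = inj₁ refl
... | inj₁ a≡b = dist i j a≡b
... | inj₂ a≡-b = ⊥-elim (disj i j a≡-b)

-- The sign of `a` is absorbed here: these coefficients act on `a` as 1 and -1 act on its absolute
-- value.
plus minus : ℤ → Coef
plus (+ _) = pos
plus -[1+ _ ] = neg
minus (+ _) = neg
minus -[1+ _ ] = pos

plus-value : ∀ a → coefVal (plus a) ℤ.* a ≡ + ∣ a ∣
plus-value (+ n) = ℤ.*-identityˡ (+ n)
plus-value -[1+ n ] = ℤ.-1*i≡-i -[1+ n ]

minus-value : ∀ a → coefVal (minus a) ℤ.* a ≡ ℤ.- (+ ∣ a ∣)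
minus-value (+ n) = ℤ.-1*i≡-i (+ n)
minus-value -[1+ n ] = ℤ.*-identityˡ -[1+ n ]

plus-weight : ∀ a → coefAbs (plus a) ≡ 1
plus-weight (+ _) = refl
plus-weight -[1+ _ ] = refl

minus-weight : ∀ a → coefAbs (minus a) ≡ 1
minus-weight (+ _) = refl
minus-weight -[1+ _ ] = refl

-- Termwise λ = 1 - c: the `m` ones become zeros and all other coefficients become units, whence the
-- weight.
dropSum⇒signedSum : ∀ {m k v} (A : Vec ℤ k) → DropSum m (absolutes A) v →
  Σ (Vec Coef k) λ c → weight c + m ≡ k × signedSum c A ℤ.+ + v ≡ + sum (absolutes A)
dropSum⇒signedSum [] nil = [] , refl , refl
dropSum⇒signedSum {m} {v = v} (a ∷ A) (zer s) with dropSum⇒signedSum A s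
... | c , wt , eq = plus a ∷ c , ≡-trans (cong (λ w → w + weight c + m) (plus-weight a)) (cong suc wt) , (begin
  coefVal (plus a) ℤ.* a ℤ.+ signedSum c A ℤ.+ + v  ≡⟨ cong (λ z → z ℤ.+ signedSum c A ℤ.+ + v) (plus-value a) ⟩
  + ∣ a ∣ ℤ.+ signedSum c A ℤ.+ + v                 ≡⟨ ℤ.+-assoc (+ ∣ a ∣) (signedSum c A) (+ v) ⟩
  + ∣ a ∣ ℤ.+ (signedSum c A ℤ.+ + v)               ≡⟨ cong (ℤ._+_ (+ ∣ a ∣)) eq ⟩
  + ∣ a ∣ ℤ.+ + sum (absolutes A)                   ∎)
  where open ≡-Reasoning
dropSum⇒signedSum (a ∷ A) (one {m} {v = v} s) with dropSum⇒signedSum A s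
... | c , wt , eq = zer ∷ c , ≡-trans (+-suc (weight c) m) (cong suc wt) , (begin
  + 0 ℤ.* a ℤ.+ signedSum c A ℤ.+ (+ ∣ a ∣ ℤ.+ + v)  ≡⟨ identity a (signedSum c A) (+ ∣ a ∣) (+ v) ⟩
  + ∣ a ∣ ℤ.+ (signedSum c A ℤ.+ + v)                ≡⟨ cong (ℤ._+_ (+ ∣ a ∣)) eq ⟩
  + ∣ a ∣ ℤ.+ + sum (absolutes A)                    ∎)
  where
  open ≡-Reasoning
  identity : ∀ a σ b v → + 0 ℤ.* a ℤ.+ σ ℤ.+ (b ℤ.+ v) ≡ b ℤ.+ (σ ℤ.+ v)
  identity = ℤ.solve-∀
dropSum⇒signedSum {m} (a ∷ A) (two {v = v} s) with dropSum⇒signedSum A s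
... | c , wt , eq = minus a ∷ c , ≡-trans (cong (λ w → w + weight c + m) (minus-weight a)) (cong suc wt) , (begin
  coefVal (minus a) ℤ.* a ℤ.+ signedSum c A ℤ.+ (+ (2 * ∣ a ∣) ℤ.+ + v)
    ≡⟨ cong₂ (λ z w → z ℤ.+ signedSum c A ℤ.+ (w ℤ.+ + v)) (minus-value a) (ℤ.pos-* 2 ∣ a ∣) ⟩
  ℤ.- (+ ∣ a ∣) ℤ.+ signedSum c A ℤ.+ (+ 2 ℤ.* + ∣ a ∣ ℤ.+ + v)
    ≡⟨ identity (+ ∣ a ∣) (signedSum c A) (+ v) ⟩
  + ∣ a ∣ ℤ.+ (signedSum c A ℤ.+ + v)
    ≡⟨ cong (ℤ._+_ (+ ∣ a ∣)) eq ⟩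
  + ∣ a ∣ ℤ.+ + sum (absolutes A)  ∎)
  where
  open ≡-Reasoning
  identity : ∀ b σ v → ℤ.- b ℤ.+ σ ℤ.+ (+ 2 ℤ.* b ℤ.+ v) ≡ b ℤ.+ (σ ℤ.+ v)
  identity = ℤ.solve-∀

-- The map v ↦ S - v, with S the sum of the absolute values, injects the drop sums into the signed
-- sumset.
atLeast⇒≤card : ∀ {m h n N k} (A : Vec ℤ k) → k ≡ h + m → AtLeast n (DropSum m (absolutes A)) →
                HasCard (InRestrictedSignedSumset h A) N → n ≤ N
atLeast⇒≤card {m} {h} A refl (L , uL , sL , n≤) (L′ , _ , refl , iff) = ≤-trans n≤ (≤-trans
  (≤-reflexive (sym (length-map value L)))
  (unique-⊆⇒length≤ (Unique.map⁺ value-injective uL) (All.map⁺ (All.map value∈ sL))))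
  where
  S = sum (absolutes A)
  value : ℕ → ℤ
  value v = + S ℤ.- + v
  value-injective : ∀ {u v} → value u ≡ value v → u ≡ v
  value-injective eq = ℤ.+-injective (ℤ.neg-injective (ℤ-Group.∙-cancelˡ (+ S) _ _ eq))
  value∈ : ∀ {v} → DropSum m (absolutes A) v → value v ∈ L′
  value∈ {v} s with dropSum⇒signedSum A s
  ... | c , wt , eq = Equivalence.from (iff (value v))
    (c , +-cancelʳ-≡ m _ _ wt , ≡-trans (identity (signedSum c A) (+ v)) (cong (ℤ._- + v) eq))
    where
    identity : ∀ σ v → σ ≡ σ ℤ.+ v ℤ.- v
    identity = ℤ.solve-∀

-- Sorting the absolute values and conclusion

descending-sort : ∀ as → Unique as → Descending (sort as)
descending-sort as uas = AllPairs.zipWith (λ (b≤a , a≢b) → ≤∧≢⇒< b≤a (a≢b ∘ sym))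
  ( Linked⇒AllPairs (λ p q → ≤-trans q p) (sort-↗ as)
  , Permutationₛ.Unique-resp-↭ (setoid ℕ) (↭⇒↭ₛ (↭-sym (sort-↭ as))) uas)

∈-odds⁻ : ∀ d n {y} → y ∈ odds d n → ∃ λ j → j < n × y ≡ d * (2 * j + 1)
∈-odds⁻ d (suc n) (here refl) = n , ≤-refl , refl
∈-odds⁻ d (suc n) (there y∈) with ∈-odds⁻ d n y∈
... | j , j<n , eq = j , m≤n⇒m≤1+n j<n , eq

∈-odds⁺ : ∀ d n {j} → j < n → d * (2 * j + 1) ∈ odds d n
∈-odds⁺ d (suc n) {j} (s≤s j≤n) with j ≟ n
... | yes refl = here refl
... | no j≢n = there (∈-odds⁺ d n (≤∧≢⇒< j≤n j≢n))

theorem4 : (h k : ℕ) → 3 ≤ h → h ≤ k ∸ 1 → (A : Vec ℤ k) → Distinct A → DisjointFromNeg A →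
    HasCard (InRestrictedSignedSumset h A) (2 * h * k ∸ h * h + 1) →
    (d : ℕ) → IsMinAbs A d →
    ∀ y → InAbs A y ⇔ Σ ℕ (λ j → j < k × y ≡ d * (2 * j + 1))
theorem4 (suc (suc (suc h))) (suc k) (s≤s (s≤s (s≤s z≤n))) h≤k A dist disj card d (d∈A , d≤) y
  with m≤n⇒∃[o]m+o≡n h≤k
... | m , refl = characterise (proj₂ (many-dropSums m h as |as| (descending-sort _ unique) positive))
  where
  as : List ℕ
  as = sort (absolutes A)
  unique : Unique (absolutes A)
  unique = unique-absolutes A (abs-injective A dist disj)
  positive : All (0 <_) as
  positive = All-resp-↭ (↭-sym (sort-↭ _)) (positive-absolutes A disj)
  |as| : length as ≡ suc m + (3 + h)
  |as| = ≡-trans (↭-length (sort-↭ _)) (≡-trans (length-absolutes A) (cong suc (+-comm (3 + h) m)))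
  -- The first term exceeds the square subtracted, so `∸` does not truncate.
  card≡ : 2 * (3 + h) * suc (3 + h + m) ∸ (3 + h) * (3 + h) + 1 ≡ 2 * suc m * (3 + h) + (3 + h) * (3 + h) + 1
  card≡ = cong (_+ 1) (≡-trans (cong (_∸ (3 + h) * (3 + h)) (identity h m))
                               (m+n∸n≡m (2 * suc m * (3 + h) + (3 + h) * (3 + h)) ((3 + h) * (3 + h))))
    where
    identity : ∀ h m → 2 * (3 + h) * suc (3 + h + m) ≡
               2 * suc m * (3 + h) + (3 + h) * (3 + h) + (3 + h) * (3 + h)
    identity = solve-∀
  characterise : IsOdds as ⊎ AtLeast (suc (2 * suc m * (3 + h) + (3 + h) * (3 + h) + 1)) (DropSum (suc m) as) →
                 InAbs A y ⇔ Σ ℕ (λ j → j < suc (3 + h + m) × y ≡ d * (2 * j + 1))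
  characterise (inj₂ more) = ⊥-elim (<-irrefl (sym card≡)
    (atLeast⇒≤card A (sym (+-suc (3 + h) m)) (atLeast-⊆ (dropSum-↭ (sort-↭ _)) more) card))
  characterise (inj₁ (e , n , as≡)) = subst
    (λ d → InAbs A y ⇔ Σ ℕ (λ j → j < suc (3 + h + m) × y ≡ d * (2 * j + 1))) e≡d
    (mk⇔ (λ y∈ → ∈-odds⁻ e K (in-odds y∈)) (λ { (j , j<K , refl) → from-odds (∈-odds⁺ e K j<K) }))
    where
    K = suc (3 + h + m)
    n≡K : n ≡ K
    n≡K = ≡-trans (sym (length-odds e n)) (≡-trans (cong length (sym as≡)) (≡-trans |as| (cong suc (+-comm m (3 + h)))))
    as≡odds : as ≡ odds e K
    as≡odds = ≡-trans as≡ (cong (odds e) n≡K)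
    in-odds : ∀ {y} → InAbs A y → y ∈ odds e K
    in-odds y∈ = subst (_ ∈_) as≡odds (∈-resp-↭ (↭-sym (sort-↭ _)) (∈-absolutes⁺ A y∈))
    from-odds : ∀ {y} → y ∈ odds e K → InAbs A y
    from-odds y∈ = ∈-absolutes⁻ A (∈-resp-↭ (sort-↭ _) (subst (_ ∈_) (sym as≡odds) y∈))
    -- `d` is an odd multiple of `e`, so e ≤ d; conversely `e`, the multiple with j = 0, is itself
    -- an absolute value.
    e≡d : e ≡ d
    e≡d = ≤-antisym (All.lookup (odds-≥ e K) (in-odds d∈A))
                    (d≤ e (from-odds (subst (_∈ odds e K) (*-identityʳ e) (∈-odds⁺ e K {0} z<s))))
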